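{- Let $p$ be a prime, $q=p^{r}$, $k\geq 3$ with $k\mid(q-1)$, $F=\mathrm{GF}(q)$, and $\Phi$ the unique multiplicative subgroup of $F^{*}$ of order $k$. For $a,c\in F^{*}$ let $[a,c]_{k}=|\Phi\cap(\Phi a+c)|$. Suppose $(p,k)$ is circular and let $a\in F^{*}$. If $k$ is even, then \[ [a,1]_{k}=\begin{cases}2, & \text{if } a\in\Phi(\psi-1) \text{ for some } \psi\in\Phi\setminus\{1,-1\};\\ 1, & \text{if } a\in 2\Phi;\\ 0, & \text{otherwise}.\end{cases} \] If $k$ is odd, then \[ [a,1]_{k}=\begin{cases}2, & \text{if } p=2 \text{ and } a\in\Phi(\psi-1) \text{ for some } \psi\in\Phi\setminus\{1\};\\ 1, & \text{if } p\neq 2 \text{ and } a\in\Phi(\psi-1) \text{ for some } \psi\in\Phi\setminus\{1\};\\ 0, & \text{otherwise}.\end{cases} \]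
   Context: For a finite field $E$ and its multiplicative subgroup $\Psi$ of order $k$, the pair $(E,\Psi)$ is circular if $|\Psi a\cap(\Psi b+c)|\leq 2$ for all $a,b,c\in E^{*}$. The pair $(p,k)$ is called circular if $(\mathrm{GF}(p^{r'}),\Psi)$ is circular for some $r'\in\mathbb{N}$ with $k\mid(p^{r'}-1)$; it is known (Modisett) that then $(\mathrm{GF}(p^{r}),\Phi)$ is circular for every $r$ with $k\mid(p^{r}-1)$. -}

module Defs where

open import Level using (0ℓ)
open import Data.Nat using (ℕ; _≤_)
open import Data.List using (List; length; filter)
open import Data.List.Membership.Propositional using (_∈_)
open import Data.List.Relation.Unary.Unique.Propositional using (Unique)
open import Data.Product using (Σ; ∃; _×_)
open import Data.Nat.Divisibility using (_∣_)
open import Data.Nat using (_^_; _∸_)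
open import Relation.Nullary using (¬_)
open import Relation.Unary using (Pred; Decidable)
open import Relation.Binary.PropositionalEquality using (_≡_; _≢_)
open import Algebra.Structures using (IsCommutativeRing)

record FiniteField : Set₁ where
  infixl 7 _*_
  infixl 6 _+_
  field
    Carrier : Set
    _+_ _*_ : Carrier → Carrier → Carrier
    -_ : Carrier → Carrier
    0# 1# : Carrier
    isCommutativeRing : IsCommutativeRing _≡_ _+_ _*_ -_ 0# 1#
    0≢1 : 0# ≢ 1#
    inv : Carrier → Carrier
    inv-spec : ∀ x → x ≢ 0# → x * inv x ≡ 1#
    _≟_ : (x y : Carrier) → Relation.Nullary.Dec (x ≡ y)
    elements : List Carrier
    elements-unique : Unique elements
    elements-complete : ∀ x → x ∈ elements

  size : ℕ
  size = length elements

  _-_ : Carrier → Carrier → Carrier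
  x - y = x + (- y)

  count : {P : Pred Carrier 0ℓ} → Decidable P → ℕ
  count P? = length (filter P? elements)


record Subgroup (F : FiniteField) (k : ℕ) : Set₁ where
  open FiniteField F using (Carrier; _*_; 0#; 1#; inv)
  field
    mem : Pred Carrier 0ℓ
    mem? : Decidable mem
    one∈ : mem 1#
    mem≢0 : ∀ {x} → mem x → x ≢ 0#
    mul∈ : ∀ {x y} → mem x → mem y → mem (x * y)
    inv∈ : ∀ {x} → mem x → mem (inv x)
    order : FiniteField.count F mem? ≡ k


-- Membership in the coset Ψ a + c (for a ≠ 0):  x ∈ Ψ a + c  iff  (x - c) a⁻¹ ∈ Ψ.
module _ {F : FiniteField} {k : ℕ} (Ψ : Subgroup F k) where
  open FiniteField F using (Carrier; _*_; _-_; 0#; 1#; inv)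

  InShift : Carrier → Carrier → Pred Carrier 0ℓ
  InShift a c x = Subgroup.mem Ψ ((x - c) * inv a)

  InInter : Carrier → Carrier → Carrier → Pred Carrier 0ℓ
  InInter a b c x = InShift a 0# x × InShift b c x

  inInter? : ∀ a b c → Decidable (InInter a b c)
  inInter? a b c x with Subgroup.mem? Ψ ((x - 0#) * inv a) | Subgroup.mem? Ψ ((x - c) * inv b)
  ... | Relation.Nullary.yes p | Relation.Nullary.yes q = Relation.Nullary.yes (p Data.Product., q)
  ... | Relation.Nullary.no ¬p | _ = Relation.Nullary.no (λ z → ¬p (Data.Product.proj₁ z))
  ... | Relation.Nullary.yes _ | Relation.Nullary.no ¬q = Relation.Nullary.no (λ z → ¬q (Data.Product.proj₂ z))

  interCount : Carrier → Carrier → Carrier → ℕ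
  interCount a b c = FiniteField.count F (inInter? a b c)

  bracket : Carrier → Carrier → ℕ
  bracket a c = interCount 1# a c

  IsCircular : Set
  IsCircular = ∀ a b c → a ≢ 0# → b ≢ 0# → c ≢ 0# → interCount a b c ≤ 2

CircularPair : ℕ → ℕ → Set₁
CircularPair p k =
  Σ FiniteField λ E → Σ ℕ λ r' → FiniteField.size E ≡ p ^ r' × k ∣ p ^ r' ∸ 1 ×
    Σ (Subgroup E k) λ Ψ → IsCircular Ψ

open FiniteField public
open Subgroup public

{-# OPTIONS --safe #-}

-- x lies in Φ ∩ (Φ a + 1) iff a ∈ Φ (x − 1), and if −1 ∈ Φ then x⁻¹ lies there
-- together with x; so circularity of Φ leaves only x = −1 to discuss.  If −1 ∉ Φ,
-- two points x, y with x − 1 = l (y − 1) give x + l = 1 + l y, and so the points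
-- x, l, 1, l y of Φ on a circle centred at x + l, too many unless x = y.
--
-- Circularity is only given in some other field E of characteristic p, with a
-- subgroup Ψ of order k.  Three points of Φ a ∩ (Φ b + c) involve finitely many
-- k-th roots of unity ζ of F, and the subring they generate embeds into E with
-- the roots going to Ψ: adjoin them one by one.  If no ω ∈ Ψ were a possible
-- image of ζ, there would be polynomials P_ω with P_ω(ζ) = 0 ≠ P_ω(ω); the product
-- of the 1 − P_ω^N, where y^N = 1 for all y ≠ 0 in E, vanishes on Ψ, hence is a
-- multiple of X^k − 1, and yet it is 1 at ζ.

module Submission where

open import Defs
  using (FiniteField; Subgroup; InShift; InInter; inInter?; IsCircular; CircularPair; bracket)
open import Algebra.Bundles using (CommutativeMonoid; CommutativeRing; RawRing)
open import Algebra.Structures using (IsCommutativeMonoid; IsCommutativeRing)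
open import Data.Empty using (⊥; ⊥-elim)
open import Data.List using (List; []; _∷_; _++_; filter; foldr; length; map)
open import Data.List.Membership.Propositional using (_∈_)
open import Data.List.Membership.Propositional.Properties
  using (∈-++⁺ʳ; ∈-++⁺ˡ; ∈-++⁻; ∈-filter⁺; ∈-filter⁻; ∈-map⁺; ∈-map⁻; ∈-∃++)
open import Data.List.Membership.Propositional.Properties.WithK using (unique∧set⇒bag)
open import Data.List.Properties using (length-++)
open import Data.List.Relation.Binary.BagAndSetEquality using (∼bag⇒↭)
open import Data.List.Relation.Binary.Permutation.Propositional using (_↭_; ↭⇒↭ₛ)
open import Data.List.Relation.Binary.Permutation.Setoid.Properties using (foldr-commMonoid)
open import Data.List.Relation.Unary.All as All using (All; []; _∷_)
open import Data.List.Relation.Unary.AllPairs using ([]; _∷_)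
open import Data.List.Relation.Unary.Any using (here; there)
open import Data.List.Relation.Unary.Unique.Propositional using (Unique)
open import Data.List.Relation.Unary.Unique.Propositional.Properties using (filter⁺; map⁺)
open import Data.Maybe using (Maybe; just; nothing)
open import Data.Nat as ℕ using (ℕ; suc; s≤s; s≤s⁻¹; zero; z≤n)
open import Data.Nat.Coprimality using (coprime-Bézout; gcd≡1⇒coprime)
open import Data.Nat.Divisibility using (_∣_; _∣0; divides; ∣-refl; ∣m+n∣m⇒∣n; ∣m∣n⇒∣m+n; ∣⇒≤)
open import Data.Nat.GCD using (gcd[m,n]∣m; gcd[m,n]∣n; module Bézout)
open import Data.Nat.Primality using (Prime; prime⇒irreducible; prime⇒nonTrivial; prime⇒nonZero)
import Data.Nat.Properties as ℕₚ
open import Data.Product using (Σ; ∃; ∃₂; _×_; _,_; proj₁; proj₂)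
open import Data.Sum using (inj₁; inj₂)
open import Data.Vec as Vec using (Vec; []; _∷_; _∷ʳ_; initLast; replicate; zipWith)
open import Data.Vec.Relation.Unary.All as Vecᴬ using ([]; _∷_)
open import Function using (_∘_; id)
open import Function.Bundles using (mk⇔)
open import Level using (0ℓ)
open import Relation.Binary.PropositionalEquality as ≡
  using (_≡_; _≢_; cong; cong₂; refl; subst; subst₂; sym; trans; module ≡-Reasoning)
open import Relation.Nullary using (¬_; Dec; contradiction; no; yes; ¬?)
open import Relation.Unary using (Decidable; Pred)

-- Integer coefficients for the ring solver

-- The solver decides identities up to a coefficient ring; ℤ, as normalised
-- differences of naturals, makes cancellation visible in every commutative ring.
module IntegerCoefficients {c ℓ} (R : CommutativeRing c ℓ) where
  open CommutativeRing R renaming (refl to ≈-refl; sym to ≈-sym; trans to ≈-trans)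
  open import Algebra.Properties.Semiring.Mult semiring
    using (×-homo-+; ×1-homo-*) renaming (_×_ to _×ᴿ_)
  open import Algebra.Properties.Ring ring
    using (-‿distribˡ-*; -‿distribʳ-*; -0#≈0#; -‿involutive)
  open import Algebra.Properties.AbelianGroup +-abelianGroup using (⁻¹-∙-comm)
  open import Algebra.Solver.Ring.AlmostCommutativeRing
    using (_-Raw-AlmostCommutative⟶_; fromCommutativeRing)
  open import Algebra.Solver.Ring.NaturalCoefficients.Default commutativeSemiring
    using () renaming (solve to solveℕ; _:+_ to _⊕_; _:*_ to _⊗_; _:=_ to _⊜_)
  open import Relation.Binary.Reasoning.Setoid setoid

  private
    normalise : ℕ × ℕ → ℕ × ℕ
    normalise (suc m , suc n) = normalise (m , n)
    normalise c               = c

    difference : ℕ × ℕ → Carrier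
    difference (m , n) = m ×ᴿ 1# - n ×ᴿ 1#

    -- The two special values let the constants of solver expressions stand for
    -- 0# and 1# definitionally.
    ⟦_⟧ᶜ : ℕ × ℕ → Carrier
    ⟦ 0 , 0 ⟧ᶜ = 0#
    ⟦ 1 , 0 ⟧ᶜ = 1#
    ⟦ c ⟧ᶜ     = difference c

    ⟦⟧-difference : ∀ c → ⟦ c ⟧ᶜ ≈ difference c
    ⟦⟧-difference (0 , 0)           = ≈-sym (-‿inverseʳ 0#)
    ⟦⟧-difference (0 , suc n)       = ≈-refl
    ⟦⟧-difference (1 , 0)           = begin
      1#              ≈⟨ +-identityʳ 1# ⟨
      1# + 0#         ≈⟨ +-identityʳ _ ⟨
      1# + 0# + 0#    ≈⟨ +-congˡ -0#≈0# ⟨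
      1# + 0# - 0#    ∎
    ⟦⟧-difference (1 , suc n)       = ≈-refl
    ⟦⟧-difference (suc (suc m) , n) = ≈-refl

    cancel-suc : ∀ x y → (1# + x) - (1# + y) ≈ x - y
    cancel-suc x y = begin
      (1# + x) - (1# + y)         ≈⟨ +-congˡ (⁻¹-∙-comm 1# y) ⟨
      (1# + x) + (- 1# + - y)     ≈⟨ solveℕ 4 (λ o x m y → (o ⊕ x) ⊕ (m ⊕ y) ⊜ (o ⊕ m) ⊕ (x ⊕ y))
           ≈-refl 1# x (- 1#) (- y) ⟩
      (1# + - 1#) + (x + - y)     ≈⟨ +-congʳ (-‿inverseʳ 1#) ⟩
      0# + (x + - y)              ≈⟨ +-identityˡ _ ⟩
      x - y                       ∎

    normalise-difference : ∀ c → difference (normalise c) ≈ difference c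
    normalise-difference (0 , n)         = ≈-refl
    normalise-difference (suc m , 0)     = ≈-refl
    normalise-difference (suc m , suc n) =
      ≈-trans (normalise-difference (m , n)) (≈-sym (cancel-suc (m ×ᴿ 1#) (n ×ᴿ 1#)))

    coefficients : RawRing _ _
    coefficients = record
      { Carrier = ℕ × ℕ
      ; _≈_     = _≡_
      ; _+_     = λ (m , n) (m′ , n′) → normalise (m ℕ.+ m′ , n ℕ.+ n′)
      ; _*_     = λ (m , n) (m′ , n′) → normalise (m ℕ.* m′ ℕ.+ n ℕ.* n′ , m ℕ.* n′ ℕ.+ n ℕ.* m′)
      ; -_      = λ (m , n) → n , m
      ; 0#      = 0 , 0
      ; 1#      = 1 , 0
      }
    module C = RawRing coefficients

    ⟦⟧-normalise : ∀ c → ⟦ normalise c ⟧ᶜ ≈ difference c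
    ⟦⟧-normalise c = ≈-trans (⟦⟧-difference (normalise c)) (normalise-difference c)

    ⟦⟧-homo-+ : ∀ c d → ⟦ c C.+ d ⟧ᶜ ≈ ⟦ c ⟧ᶜ + ⟦ d ⟧ᶜ
    ⟦⟧-homo-+ c@(m , n) d@(m′ , n′) = begin
      ⟦ c C.+ d ⟧ᶜ
        ≈⟨ ⟦⟧-normalise (m ℕ.+ m′ , n ℕ.+ n′) ⟩
      (m ℕ.+ m′) ×ᴿ 1# - (n ℕ.+ n′) ×ᴿ 1#
        ≈⟨ +-cong (×-homo-+ 1# m m′) (≈-trans (-‿cong (×-homo-+ 1# n n′)) (≈-sym (⁻¹-∙-comm N N′))) ⟩
      (M + M′) + (- N + - N′)
        ≈⟨ solveℕ 4 (λ a b c d → (a ⊕ b) ⊕ (c ⊕ d) ⊜ (a ⊕ c) ⊕ (b ⊕ d)) ≈-refl M M′ (- N) (- N′) ⟩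
      (M - N) + (M′ - N′)
        ≈⟨ +-cong (⟦⟧-difference c) (⟦⟧-difference d) ⟨
      ⟦ c ⟧ᶜ + ⟦ d ⟧ᶜ ∎
      where
      M = m ×ᴿ 1#
      M′ = m′ ×ᴿ 1#
      N = n ×ᴿ 1#
      N′ = n′ ×ᴿ 1#

    ⟦⟧-homo-* : ∀ c d → ⟦ c C.* d ⟧ᶜ ≈ ⟦ c ⟧ᶜ * ⟦ d ⟧ᶜ
    ⟦⟧-homo-* c@(m , n) d@(m′ , n′) = begin
      ⟦ c C.* d ⟧ᶜ
        ≈⟨ ⟦⟧-normalise (m ℕ.* m′ ℕ.+ n ℕ.* n′ , m ℕ.* n′ ℕ.+ n ℕ.* m′) ⟩
      (m ℕ.* m′ ℕ.+ n ℕ.* n′) ×ᴿ 1# - (m ℕ.* n′ ℕ.+ n ℕ.* m′) ×ᴿ 1#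
        ≈⟨ +-cong (expand m m′ n n′) (≈-trans (-‿cong (expand m n′ n m′)) (≈-sym (⁻¹-∙-comm _ _))) ⟩
      (M * M′ + N * N′) + (- (M * N′) + - (N * M′))
        ≈⟨ +-cong (+-congˡ negate-both) (+-cong (-‿distribʳ-* M N′) (-‿distribˡ-* N M′)) ⟩
      (M * M′ + - N * - N′) + (M * - N′ + - N * M′)
        ≈⟨ solveℕ 4 (λ a b c d → (a ⊗ b ⊕ c ⊗ d) ⊕ (a ⊗ d ⊕ c ⊗ b) ⊜ (a ⊕ c) ⊗ (b ⊕ d))
             ≈-refl M M′ (- N) (- N′) ⟩
      (M - N) * (M′ - N′)
        ≈⟨ *-cong (⟦⟧-difference c) (⟦⟧-difference d) ⟨
      ⟦ c ⟧ᶜ * ⟦ d ⟧ᶜ ∎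
      where
      M = m ×ᴿ 1#
      M′ = m′ ×ᴿ 1#
      N = n ×ᴿ 1#
      N′ = n′ ×ᴿ 1#
      expand : ∀ a b c d → (a ℕ.* b ℕ.+ c ℕ.* d) ×ᴿ 1# ≈ (a ×ᴿ 1#) * (b ×ᴿ 1#) + (c ×ᴿ 1#) * (d ×ᴿ 1#)
      expand a b c d = ≈-trans (×-homo-+ 1# (a ℕ.* b) (c ℕ.* d)) (+-cong (×1-homo-* a b) (×1-homo-* c d))
      negate-both : N * N′ ≈ - N * - N′
      negate-both = begin
        N * N′         ≈⟨ -‿involutive _ ⟨
        - - (N * N′)   ≈⟨ -‿cong (-‿distribˡ-* N N′) ⟩
        - (- N * N′)   ≈⟨ -‿distribʳ-* (- N) N′ ⟩
        - N * - N′     ∎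

    ⟦⟧-homo-neg : ∀ c → ⟦ C.- c ⟧ᶜ ≈ - ⟦ c ⟧ᶜ
    ⟦⟧-homo-neg c@(m , n) = begin
      ⟦ C.- c ⟧ᶜ                         ≈⟨ ⟦⟧-difference (n , m) ⟩
      n ×ᴿ 1# - m ×ᴿ 1#                  ≈⟨ +-comm _ _ ⟩
      - (m ×ᴿ 1#) + n ×ᴿ 1#              ≈⟨ +-congˡ (-‿involutive _) ⟨
      - (m ×ᴿ 1#) + - - (n ×ᴿ 1#)        ≈⟨ ⁻¹-∙-comm _ _ ⟩
      - (m ×ᴿ 1# - n ×ᴿ 1#)              ≈⟨ -‿cong (⟦⟧-difference c) ⟨
      - ⟦ c ⟧ᶜ                           ∎

    morphism : coefficients -Raw-AlmostCommutative⟶ fromCommutativeRing R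
    morphism = record
      { ⟦_⟧    = ⟦_⟧ᶜ
      ; +-homo = ⟦⟧-homo-+
      ; *-homo = ⟦⟧-homo-*
      ; -‿homo = ⟦⟧-homo-neg
      ; 0-homo = ≈-refl
      ; 1-homo = ≈-refl
      }

    -- Only coinciding pairs are identified, so nothing special to R enters: what the solver proves
    -- holds in every commutative ring.
    _≟ᶜ_ : ∀ c d → Maybe (⟦ c ⟧ᶜ ≈ ⟦ d ⟧ᶜ)
    (m , n) ≟ᶜ (m′ , n′) with m ℕ.≟ m′ | n ℕ.≟ n′
    ... | yes refl | yes refl = just ≈-refl
    ... | _        | _        = nothing

  open import Algebra.Solver.Ring coefficients (fromCommutativeRing R) morphism _≟ᶜ_ public
    using (Polynomial; solve; con; _:=_; _:+_; _:*_; _:-_; :-_)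

  :1 : ∀ {n} → Polynomial n
  :1 = con (1 , 0)

  :0 : ∀ {n} → Polynomial n
  :0 = con (0 , 0)

-- Counting and Lagrange's theorem

-- Pigeonhole: the head of `xs` is cut out of `ys`, and since it does not recur in the tail, the
-- tail still embeds in what remains.
unique-⊆⇒length-≤ : ∀ {A : Set} {xs ys : List A} →
  Unique xs → (∀ {x} → x ∈ xs → x ∈ ys) → length xs ℕ.≤ length ys
unique-⊆⇒length-≤ []                xs⊆ys = z≤n
unique-⊆⇒length-≤ {xs = x ∷ xs} (x∉xs ∷ xs!) xs⊆ys with ∈-∃++ (xs⊆ys (here refl))
... | as , bs , refl = begin
  suc (length xs)                   ≤⟨ s≤s (unique-⊆⇒length-≤ xs! xs⊆as++bs) ⟩
  suc (length (as ++ bs))           ≡⟨ cong suc (length-++ as) ⟩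
  suc (length as ℕ.+ length bs)     ≡⟨ ℕₚ.+-suc (length as) (length bs) ⟨
  length as ℕ.+ suc (length bs)     ≡⟨ length-++ as ⟨
  length (as ++ x ∷ bs)             ∎
  where
  open ℕₚ.≤-Reasoning
  xs⊆as++bs : ∀ {y} → y ∈ xs → y ∈ as ++ bs
  xs⊆as++bs y∈xs with ∈-++⁻ as (xs⊆ys (there y∈xs))
  ... | inj₁ y∈as         = ∈-++⁺ˡ y∈as
  ... | inj₂ (here y≡x)   = contradiction (sym y≡x) (All.lookup x∉xs y∈xs)
  ... | inj₂ (there y∈bs) = ∈-++⁺ʳ as y∈bs

module _ {A : Set} {_∙_ : A → A → A} {ε : A} (isCM : IsCommutativeMonoid _≡_ _∙_ ε) where
  private
    monoid : CommutativeMonoid 0ℓ 0ℓ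
    monoid = record { isCommutativeMonoid = isCM }
  open CommutativeMonoid monoid using (assoc; comm; identityˡ; commutativeSemigroup) renaming (monoid to mon)
  open import Algebra.Properties.CommutativeSemigroup commutativeSemigroup using (interchange)
  open import Algebra.Properties.Monoid.Mult mon renaming (_×_ to _·_)

  -- Kept to an arbitrary commutative monoid because both operations of a field need it: addition
  -- for the characteristic, multiplication for Lagrange's theorem.
  foldr-translate : ∀ g xs → foldr _∙_ ε (map (g ∙_) xs) ≡ (length xs · g) ∙ foldr _∙_ ε xs
  foldr-translate g []       = sym (identityˡ ε)
  foldr-translate g (x ∷ xs) =
    trans (cong ((g ∙ x) ∙_) (foldr-translate g xs)) (interchange g x _ _)

  -- Translation by g permutes xs, so the product P of xs satisfies P = gⁿ P.
  power-fixes-product : ∀ {g h xs} → g ∙ h ≡ ε → Unique xs →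
    (∀ {x} → x ∈ xs → (g ∙ x) ∈ xs) → (∀ {x} → x ∈ xs → (h ∙ x) ∈ xs) →
    (length xs · g) ∙ foldr _∙_ ε xs ≡ foldr _∙_ ε xs
  power-fixes-product {g} {h} {xs} gh≡ε xs! g-closed h-closed =
    trans (sym (foldr-translate g xs))
          (foldr-commMonoid (≡.setoid A) isCM (↭⇒↭ₛ translate-↭))
    where
    cancel : ∀ {a b} → a ∙ b ≡ ε → ∀ x → a ∙ (b ∙ x) ≡ x
    cancel ab≡ε x = trans (sym (assoc _ _ x)) (trans (cong (_∙ x) ab≡ε) (identityˡ x))
    hg≡ε : h ∙ g ≡ ε
    hg≡ε = trans (comm h g) gh≡ε
    translate-injective : ∀ {x y} → g ∙ x ≡ g ∙ y → x ≡ y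
    translate-injective {x} {y} gx≡gy =
      trans (sym (cancel hg≡ε x)) (trans (cong (h ∙_) gx≡gy) (cancel hg≡ε y))
    ⊆xs : ∀ {x} → x ∈ map (g ∙_) xs → x ∈ xs
    ⊆xs x∈ with ∈-map⁻ (g ∙_) x∈
    ... | y , y∈xs , refl = g-closed y∈xs
    ⊇xs : ∀ {x} → x ∈ xs → x ∈ map (g ∙_) xs
    ⊇xs {x} x∈xs = subst (_∈ map (g ∙_) xs) (cancel gh≡ε x) (∈-map⁺ (g ∙_) (h-closed x∈xs))
    translate-↭ : map (g ∙_) xs ↭ xs
    translate-↭ = ∼bag⇒↭ (unique∧set⇒bag (map⁺ translate-injective xs!) xs! (mk⇔ ⊆xs ⊇xs))

module Field (F : FiniteField) where
  open FiniteField F public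
  open IsCommutativeRing isCommutativeRing public
    using (+-comm; +-identityˡ; +-identityʳ; -‿inverseˡ; -‿inverseʳ; *-assoc; *-comm;
           *-identityˡ; *-identityʳ; zeroˡ; zeroʳ;
           +-isCommutativeMonoid; *-isCommutativeMonoid)

  commutativeRing : CommutativeRing 0ℓ 0ℓ
  commutativeRing = record { isCommutativeRing = isCommutativeRing }

  open CommutativeRing commutativeRing using (semiring; ring) public
  open import Algebra.Properties.Semiring.Exp semiring public using (_^_)
  open import Algebra.Properties.Semiring.Mult semiring public
    using (×-homo-+; ×1-homo-*) renaming (_×_ to _·_)
  open IntegerCoefficients commutativeRing public

  *-nonzero : ∀ {x y} → x ≢ 0# → y ≢ 0# → x * y ≢ 0#
  *-nonzero {x} {y} x≢0 y≢0 xy≡0 = y≢0 (begin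
    y                ≡⟨ *-identityˡ y ⟨
    1# * y           ≡⟨ cong (_* y) (inv-spec x x≢0) ⟨
    x * inv x * y    ≡⟨ solve 3 (λ x i y → x :* i :* y := i :* (x :* y)) refl x (inv x) y ⟩
    inv x * (x * y)  ≡⟨ cong (inv x *_) xy≡0 ⟩
    inv x * 0#       ≡⟨ zeroʳ (inv x) ⟩
    0#               ∎)
    where open ≡-Reasoning

  *-cancelˡ-zero : ∀ {x y} → x ≢ 0# → x * y ≡ 0# → y ≡ 0#
  *-cancelˡ-zero {x} {y} x≢0 xy≡0 with y ≟ 0#
  ... | yes y≡0 = y≡0
  ... | no y≢0  = contradiction xy≡0 (*-nonzero x≢0 y≢0)

  inv≢0 : ∀ {x} → x ≢ 0# → inv x ≢ 0#
  inv≢0 {x} x≢0 i≡0 = 0≢1 (trans (sym (zeroʳ x)) (trans (cong (x *_) (sym i≡0)) (inv-spec x x≢0)))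

  difference≡0⇒≡ : ∀ {x y} → x + (- y) ≡ 0# → x ≡ y
  difference≡0⇒≡ {x} {y} x-y≡0 = begin
    x                ≡⟨ solve 2 (λ x y → x := (x :- y) :+ y) refl x y ⟩
    (x + (- y)) + y  ≡⟨ cong (_+ y) x-y≡0 ⟩
    0# + y           ≡⟨ +-identityˡ y ⟩
    y                ∎
    where open ≡-Reasoning

  ≢⇒difference≢0 : ∀ {x y} → x ≢ y → x + (- y) ≢ 0#
  ≢⇒difference≢0 x≢y = x≢y ∘ difference≡0⇒≡

  *-cancelʳ : ∀ {x y z} → z ≢ 0# → x * z ≡ y * z → x ≡ y
  *-cancelʳ {x} {y} {z} z≢0 xz≡yz with x ≟ y
  ... | yes x≡y = x≡y
  ... | no x≢y  = contradiction (begin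
    (x + (- y)) * z      ≡⟨ solve 3 (λ x y z → (x :- y) :* z := x :* z :- y :* z) refl x y z ⟩
    x * z + (- (y * z))  ≡⟨ cong (λ w → w + (- (y * z))) xz≡yz ⟩
    y * z + (- (y * z))  ≡⟨ -‿inverseʳ (y * z) ⟩
    0#                   ∎) (*-nonzero (≢⇒difference≢0 x≢y) z≢0)
    where open ≡-Reasoning

  +-cancelʳ : ∀ {x y z} → x + z ≡ y + z → x ≡ y
  +-cancelʳ {x} {y} {z} x+z≡y+z = begin
    x                ≡⟨ solve 2 (λ x z → x := x :+ z :- z) refl x z ⟩
    x + z + (- z)    ≡⟨ cong (λ w → w + (- z)) x+z≡y+z ⟩
    y + z + (- z)    ≡⟨ solve 2 (λ y z → y :+ z :- z := y) refl y z ⟩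
    y                ∎
    where open ≡-Reasoning

  sum≡0⇒≡- : ∀ {x y} → x + y ≡ 0# → y ≡ - x
  sum≡0⇒≡- {x} {y} x+y≡0 = +-cancelʳ (begin
    y + x            ≡⟨ +-comm y x ⟩
    x + y            ≡⟨ x+y≡0 ⟩
    0#               ≡⟨ -‿inverseˡ x ⟨
    (- x) + x        ∎)
    where open ≡-Reasoning

  module _ {P : Pred Carrier 0ℓ} (P? : Decidable P) where

    count-≥ : ∀ {xs} → Unique xs → All P xs → length xs ℕ.≤ count P?
    count-≥ xs! Pxs = unique-⊆⇒length-≤ xs! λ {x} x∈xs →
      ∈-filter⁺ P? (elements-complete x) (All.lookup Pxs x∈xs)

    count-≤ : ∀ {xs} → (∀ {x} → P x → x ∈ xs) → count P? ℕ.≤ length xs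
    count-≤ P⊆xs = unique-⊆⇒length-≤ (filter⁺ P? elements-unique) λ {x} x∈ →
      P⊆xs (proj₂ (∈-filter⁻ P? {xs = elements} x∈))

    count≡0 : (∀ {x} → ¬ P x) → count P? ≡ 0
    count≡0 ¬P = ℕₚ.n≤0⇒n≡0 (count-≤ {[]} (λ Px → contradiction Px ¬P))

    count≡1 : ∀ {x} → P x → (∀ {y} → P y → y ≡ x) → count P? ≡ 1
    count≡1 {x} Px unique = ℕₚ.≤-antisym
      (count-≤ {x ∷ []} (here ∘ unique))
      (count-≥ {x ∷ []} ([] ∷ []) (Px ∷ []))

    count≥2 : ∀ {x y} → x ≢ y → P x → P y → 2 ℕ.≤ count P?
    count≥2 {x} {y} x≢y Px Py = count-≥ {x ∷ y ∷ []} ((x≢y ∷ []) ∷ [] ∷ []) (Px ∷ Py ∷ [])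

    count≥3 : ∀ {x y z} → x ≢ y → x ≢ z → y ≢ z → P x → P y → P z → 3 ℕ.≤ count P?
    count≥3 {x} {y} {z} x≢y x≢z y≢z Px Py Pz =
      count-≥ {x ∷ y ∷ z ∷ []} ((x≢y ∷ x≢z ∷ []) ∷ (y≢z ∷ []) ∷ [] ∷ []) (Px ∷ Py ∷ Pz ∷ [])

    count≤2 : (∀ {x y z} → x ≢ y → x ≢ z → y ≢ z → P x → P y → P z → ⊥) → count P? ℕ.≤ 2
    count≤2 no-three = bound (filter⁺ P? elements-unique)
      (λ x∈ → proj₂ (∈-filter⁻ P? {xs = elements} x∈))
      where
      bound : ∀ {xs} → Unique xs → (∀ {x} → x ∈ xs → P x) → length xs ℕ.≤ 2
      bound {[]}             _ _ = z≤n
      bound {_ ∷ []}         _ _ = s≤s z≤n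
      bound {_ ∷ _ ∷ []}     _ _ = s≤s (s≤s z≤n)
      bound {_ ∷ _ ∷ _ ∷ _} ((x≢y ∷ x≢z ∷ _) ∷ (y≢z ∷ _) ∷ _) Pxs =
        ⊥-elim (no-three x≢y x≢z y≢z
          (Pxs (here refl)) (Pxs (there (here refl))) (Pxs (there (there (here refl)))))

  -- Adding 1 permutes the field, so the sum of all elements does not change when `size · 1#` is
  -- added to it.
  size·1≡0 : size · 1# ≡ 0#
  size·1≡0 = +-cancelʳ (trans (power-fixes-product +-isCommutativeMonoid
    (-‿inverseʳ 1#) elements-unique (λ _ → elements-complete _) (λ _ → elements-complete _))
    (sym (+-identityˡ _)))

  nonzero? : Decidable (_≢ 0#)
  nonzero? x = ¬? (x ≟ 0#)

  units : Subgroup F (count nonzero?)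
  units = record
    { mem   = _≢ 0#
    ; mem?  = nonzero?
    ; one∈  = 0≢1 ∘ sym
    ; mem≢0 = λ x≢0 → x≢0
    ; mul∈  = *-nonzero
    ; inv∈  = inv≢0
    ; order = refl
    }

  module _ {k} (Φ : Subgroup F k) where
    open Subgroup Φ

    members : List Carrier
    members = filter mem? elements

    members-unique : Unique members
    members-unique = filter⁺ mem? elements-unique

    mem⇒∈members : ∀ {x} → mem x → x ∈ members
    mem⇒∈members x∈Φ = ∈-filter⁺ mem? (elements-complete _) x∈Φ

    ∈members⇒mem : ∀ {x} → x ∈ members → mem x
    ∈members⇒mem x∈ = proj₂ (∈-filter⁻ mem? {xs = elements} x∈)

    order-positive : 1 ℕ.≤ k
    order-positive = subst (1 ℕ.≤_) order (count-≥ mem? {1# ∷ []} ([] ∷ []) (one∈ ∷ []))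

    -- Multiplication by x permutes the subgroup, so the product of its members absorbs the factor
    -- xᵏ; that product is nonzero and cancels.
    lagrange : ∀ {x} → mem x → x ^ k ≡ 1#
    lagrange {x} x∈Φ = subst (λ n → x ^ n ≡ 1#) order (*-cancelʳ product≢0 (trans
      (power-fixes-product *-isCommutativeMonoid (inv-spec x (mem≢0 x∈Φ)) members-unique
        (λ y∈ → mem⇒∈members (mul∈ x∈Φ (∈members⇒mem y∈)))
        (λ y∈ → mem⇒∈members (mul∈ (inv∈ x∈Φ) (∈members⇒mem y∈))))
      (sym (*-identityˡ _))))
      where
      product-nonzero : ∀ {xs} → All (_≢ 0#) xs → foldr _*_ 1# xs ≢ 0#
      product-nonzero []           = 0≢1 ∘ sym
      product-nonzero (x≢0 ∷ xs≢0) = *-nonzero x≢0 (product-nonzero xs≢0)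
      product≢0 : foldr _*_ 1# members ≢ 0#
      product≢0 = product-nonzero (All.tabulate (mem≢0 ∘ ∈members⇒mem))

  -- Inversion as a power, with one exponent for all x. Products suffice to form it, so partial
  -- homomorphisms respect it, whereas they carry no information on `inv`.
  power-inverse : ∃ λ n → ∀ {x} → x ≢ 0# → x * x ^ n ≡ 1#
  power-inverse = ℕ.pred (count nonzero?) , λ {x} x≢0 →
    subst (λ n → x ^ n ≡ 1#) (sym (ℕₚ.suc-pred _ ⦃ ℕ.>-nonZero (order-positive units) ⦄)) (lagrange units x≢0)

-- Polynomials

module Polynomials (F : FiniteField) where
  open Field F

  -- A coefficient vector over an arbitrary type A, read in the field through ⟦_⟧.
  module _ {A : Set} (⟦_⟧ : A → Carrier) where

    eval : ∀ {n} → Vec A n → Carrier → Carrier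
    eval []       x = 0#
    eval (c ∷ cs) x = ⟦ c ⟧ + x * eval cs x

    -- Synthetic division: the coefficients of (P(X) - P(a)) / (X - a) are the values at a of the
    -- nonempty proper tails of P.
    quotient : ∀ {n} → Carrier → Vec A (suc n) → Vec Carrier n
    quotient a (c ∷ [])          = []
    quotient a (c ∷ cs@(_ ∷ _))  = eval cs a ∷ quotient a cs

  module _ {A : Set} {⟦_⟧ : A → Carrier} where

    eval-zipWith : ∀ {_∙_ : A → A → A} → (∀ c d → ⟦ c ∙ d ⟧ ≡ ⟦ c ⟧ + ⟦ d ⟧) →
      ∀ {n} (cs ds : Vec A n) x → eval ⟦_⟧ (zipWith _∙_ cs ds) x ≡ eval ⟦_⟧ cs x + eval ⟦_⟧ ds x
    eval-zipWith homo []       []       x = sym (+-identityˡ 0#)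
    eval-zipWith homo (c ∷ cs) (d ∷ ds) x =
      trans (cong₂ (λ u v → u + x * v) (homo c d) (eval-zipWith homo cs ds x))
        (solve 5 (λ c d x u v → (c :+ d) :+ x :* (u :+ v) := (c :+ x :* u) :+ (d :+ x :* v)) refl
          ⟦ c ⟧ ⟦ d ⟧ x (eval ⟦_⟧ cs x) (eval ⟦_⟧ ds x))

    eval-map : ∀ {h : A → A} {s} → (∀ c → ⟦ h c ⟧ ≡ s * ⟦ c ⟧) →
      ∀ {n} (cs : Vec A n) x → eval ⟦_⟧ (Vec.map h cs) x ≡ s * eval ⟦_⟧ cs x
    eval-map {s = s} homo []       x = sym (zeroʳ s)
    eval-map {s = s} homo (c ∷ cs) x =
      trans (cong₂ (λ u v → u + x * v) (homo c) (eval-map homo cs x))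
        (solve 4 (λ s c x u → s :* c :+ x :* (s :* u) := s :* (c :+ x :* u)) refl
          s ⟦ c ⟧ x (eval ⟦_⟧ cs x))

    eval-zeros : ∀ {n} {cs : Vec A n} → Vecᴬ.All (λ c → ⟦ c ⟧ ≡ 0#) cs → ∀ x → eval ⟦_⟧ cs x ≡ 0#
    eval-zeros []         x = refl
    eval-zeros (c≡0 ∷ cs≡0) x =
      trans (cong₂ (λ u v → u + x * v) c≡0 (eval-zeros cs≡0 x)) (trans (+-identityˡ _) (zeroʳ x))

    eval-replicate-zero : ∀ n {c} → ⟦ c ⟧ ≡ 0# → ∀ x → eval ⟦_⟧ (replicate n c) x ≡ 0#
    eval-replicate-zero zero    c≡0 x = refl
    eval-replicate-zero (suc n) c≡0 x =
      trans (cong₂ (λ u v → u + x * v) c≡0 (eval-replicate-zero n c≡0 x))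
        (trans (+-identityˡ _) (zeroʳ x))

    eval-∷ʳ : ∀ {n} (cs : Vec A n) c x → eval ⟦_⟧ (cs ∷ʳ c) x ≡ eval ⟦_⟧ cs x + x ^ n * ⟦ c ⟧
    eval-∷ʳ []       c x =
      solve 2 (λ c x → c :+ x :* :0 := :0 :+ :1 :* c) refl ⟦ c ⟧ x
    eval-∷ʳ {suc n} (d ∷ cs) c x = trans (cong (λ u → ⟦ d ⟧ + x * u) (eval-∷ʳ cs c x))
      (solve 5 (λ d x u w c → d :+ x :* (u :+ w :* c) := d :+ x :* u :+ x :* w :* c) refl
        ⟦ d ⟧ x (eval ⟦_⟧ cs x) (x ^ n) ⟦ c ⟧)

    -- Modulo Xⁿ⁺¹ - 1, multiplication by X rotates the coefficients cyclically.
    eval-rotate : ∀ {n} (cs : Vec A n) c {x} → x ^ suc n ≡ 1# →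
      eval ⟦_⟧ (c ∷ cs) x ≡ x * eval ⟦_⟧ (cs ∷ʳ c) x
    eval-rotate {n} cs c {x} xⁿ⁺¹≡1 = begin
      ⟦ c ⟧ + x * u                ≡⟨ cong (_+ x * u) (*-identityˡ ⟦ c ⟧) ⟨
      1# * ⟦ c ⟧ + x * u           ≡⟨ cong (λ w → w * ⟦ c ⟧ + x * u) xⁿ⁺¹≡1 ⟨
      x * x ^ n * ⟦ c ⟧ + x * u    ≡⟨ solve 4 (λ x w c u → x :* w :* c :+ x :* u := x :* (u :+ w :* c))
           refl x (x ^ n) ⟦ c ⟧ u ⟩
      x * (u + x ^ n * ⟦ c ⟧)      ≡⟨ cong (x *_) (eval-∷ʳ cs c x) ⟨
      x * eval ⟦_⟧ (cs ∷ʳ c) x     ∎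
      where
      open ≡-Reasoning
      u = eval ⟦_⟧ cs x

    eval-quotient : ∀ {n} a (cs : Vec A (suc n)) x →
      eval ⟦_⟧ cs x + (- eval ⟦_⟧ cs a) ≡ (x + (- a)) * eval id (quotient ⟦_⟧ a cs) x
    eval-quotient a (c ∷ []) x =
      solve 3 (λ c x a → (c :+ x :* :0) :- (c :+ a :* :0) := (x :- a) :* :0) refl ⟦ c ⟧ x a
    eval-quotient a (c ∷ cs@(_ ∷ _)) x = begin
      (⟦ c ⟧ + x * r x) + (- (⟦ c ⟧ + a * r a))
        ≡⟨ solve 5 (λ c x u a v → (c :+ x :* u) :- (c :+ a :* v) := (x :- a) :* v :+ x :* (u :- v))
             refl ⟦ c ⟧ x (r x) a (r a) ⟩
      (x + (- a)) * r a + x * (r x + (- r a))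
        ≡⟨ cong (λ w → (x + (- a)) * r a + x * w) (eval-quotient a cs x) ⟩
      (x + (- a)) * r a + x * ((x + (- a)) * q)
        ≡⟨ solve 4 (λ x a v q → (x :- a) :* v :+ x :* ((x :- a) :* q) := (x :- a) :* (v :+ x :* q))
             refl x a (r a) q ⟩
      (x + (- a)) * (r a + x * q) ∎
      where
      open ≡-Reasoning
      r = eval ⟦_⟧ cs
      q = eval id (quotient ⟦_⟧ a cs) x

    -- A zero quotient means that every proper tail vanishes at a. Each coefficient is the value of
    -- one tail minus a times the value of the next, hence zero.
    zero-quotient : ∀ {n} a (cs : Vec A (suc n)) → eval ⟦_⟧ cs a ≡ 0# →
      Vecᴬ.All (_≡ 0#) (quotient ⟦_⟧ a cs) → Vecᴬ.All (λ c → ⟦ c ⟧ ≡ 0#) cs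
    zero-quotient a (c ∷ []) pa≡0 [] =
      trans (solve 2 (λ c a → c := c :+ a :* :0) refl ⟦ c ⟧ a) pa≡0 ∷ []
    zero-quotient a (c ∷ cs@(_ ∷ _)) pa≡0 (ra≡0 ∷ q≡0) =
      trans (trans (solve 2 (λ c a → c := c :+ a :* :0)
           refl ⟦ c ⟧ a) (cong (λ r → ⟦ c ⟧ + a * r) (sym ra≡0))) pa≡0
        ∷ zero-quotient a cs ra≡0 q≡0

  -- Degree below n against n distinct roots: dividing by X - a leaves the other roots in place, as
  -- there are no zero divisors. The reading `⟦_⟧` is a parameter because it becomes `id` after the
  -- first division.
  roots⇒zero : ∀ {n} {A : Set} {⟦_⟧ : A → Carrier} (cs : Vec A n) {xs} →
    Unique xs → n ℕ.≤ length xs →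
    (∀ {x} → x ∈ xs → eval ⟦_⟧ cs x ≡ 0#) → Vecᴬ.All (λ c → ⟦ c ⟧ ≡ 0#) cs
  roots⇒zero [] _ _ _ = []
  roots⇒zero {⟦_⟧ = ⟦_⟧} cs@(_ ∷ _) {a ∷ xs} (a∉xs ∷ xs!) n≤ roots =
    zero-quotient a cs (roots (here refl)) (roots⇒zero (quotient ⟦_⟧ a cs) xs! (s≤s⁻¹ n≤) quotient-root)
    where
    open ≡-Reasoning
    quotient-root : ∀ {x} → x ∈ xs → eval id (quotient ⟦_⟧ a cs) x ≡ 0#
    quotient-root {x} x∈xs = *-cancelˡ-zero (≢⇒difference≢0 (All.lookup a∉xs x∈xs ∘ sym)) (begin
      (x + (- a)) * eval id (quotient ⟦_⟧ a cs) x  ≡⟨ eval-quotient a cs x ⟨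
      eval ⟦_⟧ cs x + (- eval ⟦_⟧ cs a)            ≡⟨ cong₂ (λ u v → u + (- v)) (roots (there x∈xs)) (roots (here refl)) ⟩
      0# + (- 0#)                                  ≡⟨ -‿inverseʳ 0# ⟩
      0# ∎)

  -- Otherwise Φ and x would be k + 1 roots of Xᵏ − 1.
  root-of-unity⇒mem : ∀ {k} (Φ : Subgroup F k) {x} → x ^ k ≡ 1# → Subgroup.mem Φ x
  root-of-unity⇒mem {zero}  Φ xᵏ≡1 = contradiction (order-positive Φ) λ ()
  root-of-unity⇒mem {suc n} Φ {x} xᵏ≡1 with Subgroup.mem? Φ x
  ... | yes x∈Φ = x∈Φ
  ... | no x∉Φ  = contradiction 0≡1 0≢1
    where
    -- Xᵏ - 1 from the constant term upwards: k + 1 coefficients, matched by the k + 1 alleged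
    -- roots.
    cs : Vec Carrier (2 ℕ.+ n)
    cs = (- 1#) ∷ (replicate n 0# ∷ʳ 1#)

    cs-root : ∀ {y} → y ^ suc n ≡ 1# → eval id cs y ≡ 0#
    cs-root {y} yᵏ≡1 = begin
      (- 1#) + y * eval id (replicate n 0# ∷ʳ 1#) y
        ≡⟨ cong (λ u → (- 1#) + y * u) (eval-∷ʳ (replicate n 0#) 1# y) ⟩
      (- 1#) + y * (eval id (replicate n 0#) y + y ^ n * 1#)
        ≡⟨ cong (λ u → (- 1#) + y * (u + y ^ n * 1#)) (eval-replicate-zero n refl y) ⟩
      (- 1#) + y * (0# + y ^ n * 1#)
        ≡⟨ solve 2 (λ y w → (:- :1) :+ y :* (:0 :+ w :* :1) := (:- :1) :+ y :* w) refl y (y ^ n) ⟩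
      (- 1#) + y * y ^ n
        ≡⟨ cong ((- 1#) +_) yᵏ≡1 ⟩
      (- 1#) + 1#
        ≡⟨ -‿inverseˡ 1# ⟩
      0# ∎
      where open ≡-Reasoning

    roots-unique : Unique (x ∷ members Φ)
    roots-unique = All.tabulate (λ y∈ x≡y → x∉Φ (subst (Subgroup.mem Φ) (sym x≡y) (∈members⇒mem Φ y∈)))
      ∷ members-unique Φ

    cs-roots : ∀ {y} → y ∈ x ∷ members Φ → eval id cs y ≡ 0#
    cs-roots (here refl) = cs-root xᵏ≡1
    cs-roots (there y∈)  = cs-root (lagrange Φ (∈members⇒mem Φ y∈))

    0≡1 : 0# ≡ 1#
    0≡1 = begin
      0#          ≡⟨ -‿inverseʳ 1# ⟨
      1# + (- 1#) ≡⟨ cong (1# +_) (Vecᴬ.head (roots⇒zero cs roots-unique length≥ cs-roots)) ⟩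
      1# + 0#     ≡⟨ +-identityʳ 1# ⟩
      1#          ∎
      where
      open ≡-Reasoning
      length≥ : 2 ℕ.+ n ℕ.≤ length (x ∷ members Φ)
      length≥ = s≤s (ℕₚ.≤-reflexive (sym (Subgroup.order Φ)))

-- Partial homomorphisms between finite fields

module PartialHomomorphisms (F E : FiniteField) where
  private
    module F where
      open Field F public
      open Polynomials F public
    module E where
      open Field E public
      open Polynomials E public

  Relation : Set₁
  Relation = F.Carrier → E.Carrier → Set

  -- S is the graph of a homomorphism from a subring of F to E; by additivity,
  -- 0-rel⇒ makes it single-valued.
  record IsPartialHom (S : Relation) : Set where
    field
      1-rel  : S F.1# E.1#
      -1-rel : S (F.- F.1#) (E.- E.1#)
      +-rel  : ∀ {x x′ y y′} → S x x′ → S y y′ → S (x F.+ y) (x′ E.+ y′)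
      *-rel  : ∀ {x x′ y y′} → S x x′ → S y y′ → S (x F.* y) (x′ E.* y′)
      0-rel⇒ : ∀ {y} → S F.0# y → y ≡ E.0#

    neg-rel : ∀ {x x′} → S x x′ → S (F.- x) (E.- x′)
    neg-rel {x} {x′} s = subst₂ S
      (F.solve 1 (λ x → (F.:- F.:1) F.:* x F.:= F.:- x) refl x)
      (E.solve 1 (λ x → (E.:- E.:1) E.:* x E.:= E.:- x) refl x′)
      (*-rel -1-rel s)

    0-rel : S F.0# E.0#
    0-rel = subst₂ S (F.-‿inverseʳ F.1#) (E.-‿inverseʳ E.1#) (+-rel 1-rel -1-rel)

    ^-rel : ∀ {x x′} → S x x′ → ∀ n → S (x F.^ n) (x′ E.^ n)
    ^-rel s zero    = 1-rel
    ^-rel s (suc n) = *-rel s (^-rel s n)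

    -- If x ≠ 0 were related to 0, multiplying by the power that inverts x would relate 1 to 0;
    -- subtracting 1 would then relate 0 to -1.
    rel-0⇒ : ∀ {x} → S x E.0# → x ≡ F.0#
    rel-0⇒ {x} s with x F.≟ F.0#
    ... | yes x≡0 = x≡0
    ... | no x≢0  = contradiction (sym 1≡0) E.0≢1
      where
      open ≡-Reasoning
      n : ℕ
      n = proj₁ F.power-inverse
      1-rel-0 : S F.1# E.0#
      1-rel-0 = subst₂ S (proj₂ F.power-inverse x≢0) (E.zeroˡ _) (*-rel s (^-rel s n))
      -1≡0 : E.0# E.+ (E.- E.1#) ≡ E.0#
      -1≡0 = 0-rel⇒ (subst (λ y → S y _) (F.-‿inverseʳ F.1#) (+-rel 1-rel-0 -1-rel))
      1≡0 : E.1# ≡ E.0#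
      1≡0 = sym (E.difference≡0⇒≡ -1≡0)

    functional : ∀ {x y z} → S x y → S x z → y ≡ z
    functional {x} s t = E.difference≡0⇒≡
      (0-rel⇒ (subst (λ w → S w _) (F.-‿inverseʳ x) (+-rel s (neg-rel t))))

    injective : ∀ {x y z} → S x z → S y z → x ≡ y
    injective {z = z} s t = F.difference≡0⇒≡
      (rel-0⇒ (subst (λ w → S _ w) (E.-‿inverseʳ z) (+-rel s (neg-rel t))))

  -- Adjoin S ζ x g: x = P(ζ) and g is the polynomial function on E of the
  -- corresponding P, for a polynomial P with coefficients in the subring of F × E.
  data Adjoin (S : Relation) (ζ : F.Carrier) : F.Carrier → (E.Carrier → E.Carrier) → Set where
    const : ∀ {x y} → S x y → Adjoin S ζ x (λ _ → y)
    var   : Adjoin S ζ ζ (λ ω → ω)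
    add   : ∀ {x y g h} → Adjoin S ζ x g → Adjoin S ζ y h → Adjoin S ζ (x F.+ y) (λ ω → g ω E.+ h ω)
    mul   : ∀ {x y g h} → Adjoin S ζ x g → Adjoin S ζ y h → Adjoin S ζ (x F.* y) (λ ω → g ω E.* h ω)

  -- The correspondence P(ζ) ↦ P(ω), a partial homomorphism once ω is `Good`.
  At : Relation → F.Carrier → E.Carrier → Relation
  At S ζ ω x y = ∃ λ g → Adjoin S ζ x g × y ≡ g ω

  module Extension {S : Relation} (S-hom : IsPartialHom S) {n : ℕ} (Ψ : Subgroup E (suc n))
                   {ζ : F.Carrier} (ζᵏ≡1 : ζ F.^ suc n ≡ F.1#) where
    open IsPartialHom S-hom

    -- The subring of F × E carved out by `S`, so that one coefficient vector can be read in both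
    -- fields.
    Coefficient : Set
    Coefficient = ∃₂ S

    left : Coefficient → F.Carrier
    left (x , _ , _) = x

    right : Coefficient → E.Carrier
    right (_ , y , _) = y

    zeroᶜ : Coefficient
    zeroᶜ = _ , _ , 0-rel

    _+ᶜ_ _*ᶜ_ : Coefficient → Coefficient → Coefficient
    (_ , _ , s) +ᶜ (_ , _ , t) = _ , _ , +-rel s t
    (_ , _ , s) *ᶜ (_ , _ , t) = _ , _ , *-rel s t

    -- A representative modulo Xᵏ - 1 with exactly k coefficients, k being `suc n`; this is why
    -- agreement on the side of E is asked at k-th roots of unity only.
    record Reduced (x : F.Carrier) (g : E.Carrier → E.Carrier) : Set where
      constructor reduced
      field
        coefficients : Vec Coefficient (suc n)
        value        : x ≡ F.eval left coefficients ζ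
        function     : ∀ {ω} → ω E.^ suc n ≡ E.1# → g ω ≡ E.eval right coefficients ω

    Reduced-const : ∀ {x y} → S x y → Reduced x (λ _ → y)
    Reduced-const {x} {y} s = reduced ((_ , _ , s) ∷ replicate n zeroᶜ)
      (sym (trans (cong (λ u → x F.+ ζ F.* u) (F.eval-replicate-zero n refl ζ))
        (F.solve 2 (λ x z → x F.:+ z F.:* F.:0 F.:= x) refl x ζ)))
      (λ {ω} _ → sym (trans (cong (λ u → y E.+ ω E.* u) (E.eval-replicate-zero n refl ω))
        (E.solve 2 (λ y w → y E.:+ w E.:* E.:0 E.:= y) refl y ω)))

    Reduced-+ : ∀ {x y g h} → Reduced x g → Reduced y h → Reduced (x F.+ y) (λ ω → g ω E.+ h ω)
    Reduced-+ (reduced cs x≡ g≡) (reduced ds y≡ h≡) = reduced (zipWith _+ᶜ_ cs ds)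
      (trans (cong₂ F._+_ x≡ y≡) (sym (F.eval-zipWith (λ _ _ → refl) cs ds ζ)))
      (λ {ω} ωᵏ≡1 → trans (cong₂ E._+_ (g≡ ωᵏ≡1) (h≡ ωᵏ≡1)) (sym (E.eval-zipWith (λ _ _ → refl) cs ds ω)))

    Reduced-scale : ∀ {s t x g} → S s t → Reduced x g → Reduced (s F.* x) (λ ω → t E.* g ω)
    Reduced-scale {s} {t} st (reduced cs x≡ g≡) = reduced (Vec.map ((_ , _ , st) *ᶜ_) cs)
      (trans (cong (s F.*_) x≡) (sym (F.eval-map (λ _ → refl) cs ζ)))
      (λ {ω} ωᵏ≡1 → trans (cong (t E.*_) (g≡ ωᵏ≡1)) (sym (E.eval-map (λ _ → refl) cs ω)))

    Reduced-shift : ∀ {x g} → Reduced x g → Reduced (ζ F.* x) (λ ω → ω E.* g ω)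
    Reduced-shift (reduced cs x≡ g≡) with initLast cs
    -- The top coefficient c wraps around to the constant term.
    ... | cs′ , c , refl = reduced (c ∷ cs′)
      (trans (cong (ζ F.*_) x≡) (sym (F.eval-rotate cs′ c ζᵏ≡1)))
      (λ {ω} ωᵏ≡1 → trans (cong (ω E.*_) (g≡ ωᵏ≡1)) (sym (E.eval-rotate cs′ c ωᵏ≡1)))

    Reduced-cong : ∀ {x y g h} → x ≡ y → (∀ {ω} → ω E.^ suc n ≡ E.1# → g ω ≡ h ω) → Reduced x g → Reduced y h
    Reduced-cong x≡y g≡h (reduced cs x≡ g≡) =
      reduced cs (trans (sym x≡y) x≡) (λ ωᵏ≡1 → trans (sym (g≡h ωᵏ≡1)) (g≡ ωᵏ≡1))

    -- Horner's scheme builds a product from scalings, shifts and sums, all of which preserve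
    -- reducedness.
    Reduced-eval-* : ∀ {m y h} (cs : Vec Coefficient m) → Reduced y h →
      Reduced (F.eval left cs ζ F.* y) (λ ω → E.eval right cs ω E.* h ω)
    Reduced-eval-* {y = y} {h} [] Y =
      Reduced-cong (sym (F.zeroˡ y)) (λ _ → sym (E.zeroˡ (h _))) (Reduced-const 0-rel)
    Reduced-eval-* {y = y} {h} ((s , t , st) ∷ cs) Y = Reduced-cong
      (F.solve 4 (λ s y z u → s F.:* y F.:+ z F.:* (u F.:* y) F.:= (s F.:+ z F.:* u) F.:* y)
           refl s y ζ (F.eval left cs ζ))
      (λ {ω} _ → E.solve 4 (λ s y z u → s E.:* y E.:+ z E.:* (u E.:* y) E.:= (s E.:+ z E.:* u) E.:* y)
           refl t (h ω) ω (E.eval right cs ω))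
      (Reduced-+ (Reduced-scale st Y) (Reduced-shift (Reduced-eval-* cs Y)))

    reduce : ∀ {x g} → Adjoin S ζ x g → Reduced x g
    reduce (const s) = Reduced-const s
    reduce var       = Reduced-cong
      (F.solve 1 (λ z → z F.:* F.:1 F.:= z) refl ζ)
      (λ {ω} _ → E.solve 1 (λ w → w E.:* E.:1 E.:= w) refl ω)
      (Reduced-shift (Reduced-const 1-rel))
    reduce (add X Y) = Reduced-+ (reduce X) (reduce Y)
    reduce (mul X Y) with reduce X
    ... | reduced cs x≡ g≡ = Reduced-cong
      (cong (F._* _) (sym x≡)) (λ ωᵏ≡1 → cong (E._* _) (sym (g≡ ωᵏ≡1)))
      (Reduced-eval-* cs (reduce Y))

    -- Once reduced, the polynomial over E has k coefficients and the k members of `Ψ` as roots, so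
    -- its coefficients are zero; by `rel-0⇒` so are their partners in F.
    vanishes-on-Ψ⇒0 : ∀ {x g} → Adjoin S ζ x g → (∀ {ω} → Subgroup.mem Ψ ω → g ω ≡ E.0#) → x ≡ F.0#
    vanishes-on-Ψ⇒0 X g≡0 with reduce X
    ... | reduced cs x≡ g≡ = trans x≡ (F.eval-zeros (Vecᴬ.map (λ {c} → right⇒left {c}) cs≡0) ζ)
      where
      cs≡0 : Vecᴬ.All (λ c → right c ≡ E.0#) cs
      cs≡0 = E.roots⇒zero cs (E.members-unique Ψ) (ℕₚ.≤-reflexive (sym (Subgroup.order Ψ)))
        (λ ω∈ → let ω∈Ψ = E.∈members⇒mem Ψ ω∈ in
          trans (sym (g≡ (E.lagrange Ψ ω∈Ψ))) (g≡0 ω∈Ψ))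
      right⇒left : ∀ {c} → right c ≡ E.0# → left c ≡ F.0#
      right⇒left {x , y , s} refl = rel-0⇒ s

    -- The condition for P(ζ) ↦ P(ω) to be well defined.
    Good : E.Carrier → Set
    Good ω = ∀ {x g} → Adjoin S ζ x g → x ≡ F.0# → g ω ≡ E.0#

    one-minus : ∀ {x g} → Adjoin S ζ x g →
      Adjoin S ζ (F.1# F.+ (F.- F.1#) F.* x) (λ ω → E.1# E.+ (E.- E.1#) E.* g ω)
    one-minus X = add (const 1-rel) (mul (const -1-rel) X)

    Adjoin-^ : ∀ {x g} → Adjoin S ζ x g → ∀ m → Adjoin S ζ (x F.^ m) (λ ω → g ω E.^ m)
    Adjoin-^ X zero    = const 1-rel
    Adjoin-^ X (suc m) = mul X (Adjoin-^ X m)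

    -- If P(ζ) = 0 ≠ P(ω), then 1 − Pᴺ takes the value 1 at ζ and 0 at ω.  The
    -- product of these over all ω ∈ Ψ would vanish on Ψ but not at ζ.
    separating : ∀ {ωs} → All (¬_ ∘ Good) ωs →
      ¬ ¬ (∃ λ g → Adjoin S ζ F.1# g × All (λ ω → g ω ≡ E.0#) ωs)
    separating []               k = k (_ , const 1-rel , [])
    separating {ω ∷ ωs} (bad ∷ bads) k =
      separating bads λ (_ , G , g≡0) → bad (λ {x} {h} → ruled-out G g≡0 {x} {h})
      where
      -- This N is positive, so xᴺ = 0 for x = 0 in F, and it is an exponent with yᴺ = 1 for all y ≠
      -- 0 in E.
      N = suc (proj₁ E.power-inverse)
      ruled-out : ∀ {g} → Adjoin S ζ F.1# g → All (λ ω → g ω ≡ E.0#) ωs →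
        ∀ {x h} → Adjoin S ζ x h → x ≡ F.0# → h ω ≡ E.0#
      ruled-out {g} G g≡0 {x} {h} H x≡0 with h ω E.≟ E.0#
      ... | yes hω≡0 = hω≡0
      ... | no hω≢0  = contradiction (_ , product , at-ω ∷ All.map at-ωs g≡0) k
        where
        f : E.Carrier → E.Carrier
        f ω = g ω E.* (E.1# E.+ (E.- E.1#) E.* h ω E.^ N)
        value : F.1# F.* (F.1# F.+ (F.- F.1#) F.* x F.^ N) ≡ F.1#
        value = trans (cong (λ u → F.1# F.* (F.1# F.+ (F.- F.1#) F.* (u F.* x F.^ proj₁ E.power-inverse))) x≡0)
          (F.solve 1 (λ u → F.:1 F.:* (F.:1 F.:+ (F.:- F.:1) F.:* (F.:0 F.:* u)) F.:= F.:1) refl _)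
        product : Adjoin S ζ F.1# f
        product = subst (λ u → Adjoin S ζ u f) value (mul G (one-minus (Adjoin-^ H N)))
        at-ω : f ω ≡ E.0#
        at-ω =
          trans (cong (λ u → g ω E.* (E.1# E.+ (E.- E.1#) E.* u)) (proj₂ E.power-inverse hω≢0))
            (E.solve 1 (λ u → u E.:* (E.:1 E.:+ (E.:- E.:1) E.:* E.:1) E.:= E.:0) refl (g ω))
        at-ωs : ∀ {ω′} → g ω′ ≡ E.0# → f ω′ ≡ E.0#
        at-ωs g≡0 = trans (cong (E._* _) g≡0) (E.zeroˡ _)

    -- `Good` quantifies over all polynomials and is not decided, hence the double negation, which
    -- is harmless because the eventual goal is ⊥.
    good-exists : ¬ ¬ (∃ λ ω → Subgroup.mem Ψ ω × Good ω)
    good-exists k = separating (All.tabulate all-bad) λ (g , G , g≡0) →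
      F.0≢1 (sym (vanishes-on-Ψ⇒0 G (All.lookup g≡0 ∘ E.mem⇒∈members Ψ)))
      where
      all-bad : ∀ {ω} → ω ∈ E.members Ψ → ¬ Good ω
      all-bad ω∈ good = k (_ , E.∈members⇒mem Ψ ω∈ , good)

    At-hom : ∀ {ω} → Good ω → IsPartialHom (At S ζ ω)
    At-hom good = record
      { 1-rel  = _ , const 1-rel , refl
      ; -1-rel = _ , const -1-rel , refl
      ; +-rel  = λ { (_ , X , refl) (_ , Y , refl) → _ , add X Y , refl }
      ; *-rel  = λ { (_ , X , refl) (_ , Y , refl) → _ , mul X Y , refl }
      ; 0-rel⇒ = λ { (_ , X , refl) → good X refl }
      }

  Covers : Relation → (E.Carrier → Set) → F.Carrier → Set
  Covers S Q x = ∃ λ y → Q y × S x y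

  -- Roots are adjoined one at a time; those already covered become constants of the next extension
  -- and keep their images in `Ψ`.
  extend-all : ∀ {n S} → IsPartialHom S → (Ψ : Subgroup E (suc n)) →
    ∀ {xs} → All (λ x → x F.^ suc n ≡ F.1#) xs →
    ¬ ¬ (Σ Relation λ T → IsPartialHom T × All (Covers T (Subgroup.mem Ψ)) xs)
  extend-all hom Ψ []             k = k (_ , hom , [])
  extend-all hom Ψ (xᵏ≡1 ∷ xsᵏ≡1) k = extend-all hom Ψ xsᵏ≡1 λ (T , T-hom , covers) →
    let open Extension T-hom Ψ xᵏ≡1 in
    good-exists λ (ω , ω∈Ψ , good) →
      k (_ , At-hom good , (ω , ω∈Ψ , _ , var , refl) ∷
         All.map (λ (y , y∈Ψ , s) → y , y∈Ψ , _ , const s , refl) covers)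

-- Transfer of circularity

module Characteristic (F : FiniteField) where
  open Field F

  private
    1·1≡1 : 1 · 1# ≡ 1#
    1·1≡1 = +-identityʳ 1#

  -- Without zero divisors, one of the r factors `p · 1#` must vanish, and r = 0 would give 1 = 0.
  power-characteristic : ∀ p r → (p ℕ.^ r) · 1# ≡ 0# → p · 1# ≡ 0#
  power-characteristic p zero    1·1≡0 = contradiction (trans (sym 1·1≡0) 1·1≡1) 0≢1
  power-characteristic p (suc r) eq with (p · 1#) ≟ 0#
  ... | yes p·1≡0 = p·1≡0
  ... | no p·1≢0  = power-characteristic p r
    (*-cancelˡ-zero p·1≢0 (trans (sym (×1-homo-* p (p ℕ.^ r))) eq))

  size-characteristic : ∀ {p r} → size ≡ p ℕ.^ r → p · 1# ≡ 0#
  size-characteristic {p} {r} size≡ = power-characteristic p r (subst (λ n → n · 1# ≡ 0#) size≡ size·1≡0)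

  multiple·1≡0 : ∀ {p} → p · 1# ≡ 0# → ∀ m → (m ℕ.* p) · 1# ≡ 0#
  multiple·1≡0 {p} p·1≡0 m = trans (×1-homo-* m p) (trans (cong (m · 1# *_) p·1≡0) (zeroʳ _))

  bézout-contradiction : ∀ {m n} → m · 1# ≡ 0# → n · 1# ≡ 0# → ∀ x y → 1 ℕ.+ y ℕ.* n ≢ x ℕ.* m
  bézout-contradiction {m} {n} m·1≡0 n·1≡0 x y eq = 0≢1 (begin
    0#                     ≡⟨ multiple·1≡0 m·1≡0 x ⟨
    (x ℕ.* m) · 1#         ≡⟨ cong (_· 1#) eq ⟨
    1# + (y ℕ.* n) · 1#    ≡⟨ cong (1# +_) (multiple·1≡0 n·1≡0 y) ⟩
    1# + 0#                ≡⟨ +-identityʳ 1# ⟩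
    1#                     ∎)
    where open ≡-Reasoning

  -- The gcd of p and n is 1 or p. If it is 1, a Bézout identity turns the two vanishing multiples
  -- of 1 into 1 = 0.
  characteristic-divides : ∀ {p n} → Prime p → p · 1# ≡ 0# → n · 1# ≡ 0# → p ∣ n
  characteristic-divides {p} {n} p-prime p·1≡0 n·1≡0
    with prime⇒irreducible p-prime (gcd[m,n]∣m p n)
  ... | inj₂ gcd≡p = subst (_∣ n) gcd≡p (gcd[m,n]∣n p n)
  ... | inj₁ gcd≡1 with coprime-Bézout (gcd≡1⇒coprime gcd≡1)
  ...   | Bézout.+- x y eq = contradiction eq (bézout-contradiction {p} {n} p·1≡0 n·1≡0 x y)
  ...   | Bézout.-+ x y eq = contradiction eq (bézout-contradiction {n} {p} n·1≡0 p·1≡0 y x)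

module Circles {F : FiniteField} {k : ℕ} (Φ : Subgroup F k) where
  open Field F
  open Subgroup Φ

  InShift⇒ : ∀ {a c x} → a ≢ 0# → InShift Φ a c x → ∃ λ u → mem u × x ≡ a * u + c
  InShift⇒ {a} {c} {x} a≢0 u∈Φ = _ , u∈Φ , sym (begin
    a * ((x + (- c)) * inv a) + c
      ≡⟨ solve 4 (λ a x c i → a :* ((x :- c) :* i) :+ c := a :* i :* (x :- c) :+ c)
           refl a x c (inv a) ⟩
    a * inv a * (x + (- c)) + c
      ≡⟨ cong (λ w → w * (x + (- c)) + c) (inv-spec a a≢0) ⟩
    1# * (x + (- c)) + c
      ≡⟨ solve 2 (λ x c → :1 :* (x :- c) :+ c := x) refl x c ⟩
    x ∎)
    where open ≡-Reasoning

  InShift⇐ : ∀ {a c x u} → a ≢ 0# → mem u → x ≡ a * u + c → InShift Φ a c x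
  InShift⇐ {a} {c} {u = u} a≢0 u∈Φ refl = subst mem (sym (begin
    (a * u + c + (- c)) * inv a
      ≡⟨ solve 4 (λ a u c i → (a :* u :+ c :- c) :* i := a :* i :* u) refl a u c (inv a) ⟩
    a * inv a * u
      ≡⟨ cong (_* u) (inv-spec a a≢0) ⟩
    1# * u
      ≡⟨ *-identityˡ u ⟩
    u ∎)) u∈Φ
    where open ≡-Reasoning

  1≢0 : 1# ≢ 0#
  1≢0 = 0≢1 ∘ sym

  unit-InInter⇐ : ∀ {b c x v} → b ≢ 0# → mem x → mem v → x ≡ b * v + c → InInter Φ 1# b c x
  unit-InInter⇐ {x = x} b≢0 x∈Φ v∈Φ x≡ =
    InShift⇐ 1≢0 x∈Φ (solve 1 (λ x → x := :1 :* x :+ :0) refl x) , InShift⇐ b≢0 v∈Φ x≡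

  unit-InInter⇒ : ∀ {b c x} → b ≢ 0# → InInter Φ 1# b c x → mem x × ∃ λ v → mem v × x ≡ b * v + c
  unit-InInter⇒ {x = x} b≢0 (left , right) = x∈Φ (InShift⇒ 1≢0 left) , InShift⇒ b≢0 right
    where
    x∈Φ : (∃ λ u → mem u × x ≡ 1# * u + 0#) → mem x
    x∈Φ (u , u∈Φ , x≡1u+0) =
      subst mem (sym (trans x≡1u+0 (solve 1 (λ u → :1 :* u :+ :0 := u) refl u))) u∈Φ

  no-three : IsCircular Φ → ∀ {b c} → b ≢ 0# → c ≢ 0# → ∀ {x y z u v w} → x ≢ y → x ≢ z → y ≢ z →
    mem x → mem u → x ≡ b * u + c → mem y → mem v → y ≡ b * v + c →
    mem z → mem w → z ≡ b * w + c → ⊥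
  no-three circular {b} {c} b≢0 c≢0 x≢y x≢z y≢z x∈ u∈ x≡ y∈ v∈ y≡ z∈ w∈ z≡ =
    contradiction (circular 1# b c 1≢0 b≢0 c≢0) (ℕₚ.<⇒≱ (count≥3 (inInter? Φ 1# b c) x≢y x≢z y≢z
      (unit-InInter⇐ b≢0 x∈ u∈ x≡) (unit-InInter⇐ b≢0 y∈ v∈ y≡) (unit-InInter⇐ b≢0 z∈ w∈ z≡)))

module Modisett {p : ℕ} (p-prime : Prime p) (F E : FiniteField) where
  open PartialHomomorphisms F E
  private
    module F where
      open Field F public
      open Characteristic F public
    module E where
      open Field E public
      open Characteristic E public

  -- When both fields have characteristic p, this is the isomorphism between their copies of GF(p),
  -- the start of the chain of extensions.
  PrimeSubfield : Relation
  PrimeSubfield x y = ∃ λ n → x ≡ n F.· F.1# × y ≡ n E.· E.1#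

  primeSubfield-hom : p F.· F.1# ≡ F.0# → p E.· E.1# ≡ E.0# → IsPartialHom PrimeSubfield
  primeSubfield-hom p·1≡0ᶠ p·1≡0ᴱ = record
    { 1-rel  = 1 , sym (F.+-identityʳ F.1#) , sym (E.+-identityʳ E.1#)
    -- Only natural multiples of 1 are available, so -1 is written as (p - 1) · 1.
    ; -1-rel = ℕ.pred p , sym (pred·1≡-1ᶠ) , sym (pred·1≡-1ᴱ)
    ; +-rel  = λ { (m , refl , refl) (n , refl , refl) →
                   m ℕ.+ n , sym (F.×-homo-+ F.1# m n) , sym (E.×-homo-+ E.1# m n) }
    ; *-rel  = λ { (m , refl , refl) (n , refl , refl) →
                   m ℕ.* n , sym (F.×1-homo-* m n) , sym (E.×1-homo-* m n) }
    -- Here primality enters: n · 1 = 0 in F forces p to divide n, and then n · 1 = 0 in E.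
    ; 0-rel⇒ = λ { (n , 0≡n·1 , refl) →
        divisible {n} (F.characteristic-divides {p} {n} p-prime p·1≡0ᶠ (sym 0≡n·1)) }
    }
    where
    p≡ : suc (ℕ.pred p) ≡ p
    p≡ = ℕₚ.suc-pred p ⦃ prime⇒nonZero p-prime ⦄
    pred·1≡-1ᶠ : ℕ.pred p F.· F.1# ≡ F.- F.1#
    pred·1≡-1ᶠ = F.sum≡0⇒≡- (subst (λ n → n F.· F.1# ≡ F.0#) (sym p≡) p·1≡0ᶠ)
    pred·1≡-1ᴱ : ℕ.pred p E.· E.1# ≡ E.- E.1#
    pred·1≡-1ᴱ = E.sum≡0⇒≡- (subst (λ n → n E.· E.1# ≡ E.0#) (sym p≡) p·1≡0ᴱ)
    divisible : ∀ {n} → p ∣ n → n E.· E.1# ≡ E.0#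
    divisible (divides m refl) = E.multiple·1≡0 p·1≡0ᴱ m

  -- The line through two points with coordinates in the domain of T has
  -- coefficients in that domain.
  module Line {T} (T-hom : IsPartialHom T) {β γ u₁ u₂ v₁ v₂ ũ₁ ũ₂ ṽ₁ ṽ₂} (v₁≢v₂ : v₁ ≢ v₂)
    (u₁~ : T u₁ ũ₁) (u₂~ : T u₂ ũ₂) (v₁~ : T v₁ ṽ₁) (v₂~ : T v₂ ṽ₂)
    (line₁ : u₁ ≡ β F.* v₁ F.+ γ) (line₂ : u₂ ≡ β F.* v₂ F.+ γ) where
    open IsPartialHom T-hom

    -- The slope is (u₁ - u₂) / (v₁ - v₂), with the division replaced by an N-th power, since `T` is
    -- only known to respect ring operations.
    N = proj₁ F.power-inverse

    β̃ γ̃ : E.Carrier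
    β̃ = (ũ₁ E.+ (E.- ũ₂)) E.* (ṽ₁ E.+ (E.- ṽ₂)) E.^ N
    γ̃ = ũ₁ E.+ (E.- (β̃ E.* ṽ₁))

    β~ : T β β̃
    β~ = subst (λ x → T x β̃) (begin
      (u₁ F.+ (F.- u₂)) F.* d
        ≡⟨ cong₂ (λ s t → (s F.+ (F.- t)) F.* d) line₁ line₂ ⟩
      (β F.* v₁ F.+ γ F.+ (F.- (β F.* v₂ F.+ γ))) F.* d
        ≡⟨ F.solve 5 (λ β γ v w d → (β F.:* v F.:+ γ F.:- (β F.:* w F.:+ γ)) F.:* d
             F.:= β F.:* ((v F.:- w) F.:* d)) refl β γ v₁ v₂ d ⟩
      β F.* ((v₁ F.+ (F.- v₂)) F.* d)
        ≡⟨ cong (β F.*_) (proj₂ F.power-inverse (F.≢⇒difference≢0 v₁≢v₂)) ⟩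
      β F.* F.1#
        ≡⟨ F.*-identityʳ β ⟩
      β ∎) (*-rel (+-rel u₁~ (neg-rel u₂~)) (^-rel (+-rel v₁~ (neg-rel v₂~)) N))
      where
      open ≡-Reasoning
      d = (v₁ F.+ (F.- v₂)) F.^ N

    γ~ : T γ γ̃
    γ~ = subst (λ x → T x γ̃)
      (trans (cong (F._+ (F.- (β F.* v₁))) line₁)
        (F.solve 2 (λ m γ → m F.:+ γ F.:- m F.:= γ) refl (β F.* v₁) γ))
      (+-rel u₁~ (neg-rel (*-rel β~ v₁~)))

    β̃≢0 : β ≢ F.0# → β̃ ≢ E.0#
    β̃≢0 β≢0 β̃≡0 = β≢0 (rel-0⇒ (subst (T β) β̃≡0 β~))

    γ̃≢0 : γ ≢ F.0# → γ̃ ≢ E.0#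
    γ̃≢0 γ≢0 γ̃≡0 = γ≢0 (rel-0⇒ (subst (T γ) γ̃≡0 γ~))

    image : ∀ {u v ũ ṽ} → T u ũ → T v ṽ → u ≡ β F.* v F.+ γ → ũ ≡ β̃ E.* ṽ E.+ γ̃
    image u~ v~ u≡ = functional u~ (subst (λ x → T x _) (sym u≡) (+-rel (*-rel β~ v~) γ~))

  -- `T` carries the line and its points into E. Injectivity keeps the points distinct and the
  -- coefficients nonzero, so Ψ ∩ (Ψ β̃ + γ̃) would have three elements.
  no-three-on-line : ∀ {n} (Ψ : Subgroup E (suc n)) → IsCircular Ψ → ∀ {T} → IsPartialHom T →
    ∀ {β γ u₁ u₂ u₃ v₁ v₂ v₃} → β ≢ F.0# → γ ≢ F.0# → v₁ ≢ v₂ → u₁ ≢ u₂ → u₁ ≢ u₃ → u₂ ≢ u₃ →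
    u₁ ≡ β F.* v₁ F.+ γ → u₂ ≡ β F.* v₂ F.+ γ → u₃ ≡ β F.* v₃ F.+ γ →
    All (Covers T (Subgroup.mem Ψ)) (u₁ ∷ u₂ ∷ u₃ ∷ v₁ ∷ v₂ ∷ v₃ ∷ []) → ⊥
  no-three-on-line Ψ circular {T} T-hom β≢0 γ≢0 v₁≢v₂ u₁≢u₂ u₁≢u₃ u₂≢u₃ line₁ line₂ line₃
    ((_ , ũ₁∈ , u₁~) ∷ (_ , ũ₂∈ , u₂~) ∷ (_ , ũ₃∈ , u₃~) ∷
     (_ , ṽ₁∈ , v₁~) ∷ (_ , ṽ₂∈ , v₂~) ∷ (_ , ṽ₃∈ , v₃~) ∷ []) =
    Circles.no-three Ψ circular (L.β̃≢0 β≢0) (L.γ̃≢0 γ≢0)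
      (images-distinct u₁~ u₂~ u₁≢u₂) (images-distinct u₁~ u₃~ u₁≢u₃) (images-distinct u₂~ u₃~ u₂≢u₃)
      ũ₁∈ ṽ₁∈ (L.image u₁~ v₁~ line₁)
      ũ₂∈ ṽ₂∈ (L.image u₂~ v₂~ line₂)
      ũ₃∈ ṽ₃∈ (L.image u₃~ v₃~ line₃)
    where
    module L = Line T-hom v₁≢v₂ u₁~ u₂~ v₁~ v₂~ line₁ line₂
    images-distinct : ∀ {x y x′ y′} → T x x′ → T y y′ → x ≢ y → x′ ≢ y′
    images-distinct s t x≢y refl = x≢y (IsPartialHom.injective T-hom s t)

  circular-transfer : ∀ {n} → p F.· F.1# ≡ F.0# → p E.· E.1# ≡ E.0# →
    (Φ : Subgroup F (suc n)) (Ψ : Subgroup E (suc n)) → IsCircular Ψ → IsCircular Φ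
  circular-transfer p·1≡0ᶠ p·1≡0ᴱ Φ Ψ circular a b c a≢0 b≢0 c≢0 = F.count≤2 (inInter? Φ a b c) no-three
    where
    -- Dividing x by a normalises the first circle to Φ itself: u = x / a and v = (x - c) / b are
    -- roots of unity with u = β v + γ.
    β γ : F.Carrier
    β = b F.* F.inv a
    γ = c F.* F.inv a

    u v : F.Carrier → F.Carrier
    u x = (x F.+ (F.- F.0#)) F.* F.inv a
    v x = (x F.+ (F.- c)) F.* F.inv b

    u-injective : ∀ {x y} → x ≢ y → u x ≢ u y
    u-injective x≢y eq = x≢y (F.+-cancelʳ (F.*-cancelʳ (F.inv≢0 a≢0) eq))

    v-injective : ∀ {x y} → x ≢ y → v x ≢ v y
    v-injective x≢y eq = x≢y (F.+-cancelʳ (F.*-cancelʳ (F.inv≢0 b≢0) eq))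

    line : ∀ x → u x ≡ β F.* v x F.+ γ
    line x = sym (begin
      b F.* F.inv a F.* ((x F.+ (F.- c)) F.* F.inv b) F.+ c F.* F.inv a
        ≡⟨ F.solve 5 (λ b i x c j → b F.:* i F.:* ((x F.:- c) F.:* j) F.:+ c F.:* i
             F.:= (b F.:* j) F.:* ((x F.:- c) F.:* i) F.:+ c F.:* i) refl b (F.inv a) x c (F.inv b) ⟩
      (b F.* F.inv b) F.* ((x F.+ (F.- c)) F.* F.inv a) F.+ c F.* F.inv a
        ≡⟨ cong (λ w → w F.* ((x F.+ (F.- c)) F.* F.inv a) F.+ c F.* F.inv a) (F.inv-spec b b≢0) ⟩
      F.1# F.* ((x F.+ (F.- c)) F.* F.inv a) F.+ c F.* F.inv a
        ≡⟨ F.solve 3 (λ x c i → F.:1 F.:* ((x F.:- c) F.:* i) F.:+ c F.:* i F.:= (x F.:- F.:0) F.:* i)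
             refl x c (F.inv a) ⟩
      u x ∎)
      where open ≡-Reasoning

    no-three : ∀ {x y z} → x ≢ y → x ≢ z → y ≢ z →
      InInter Φ a b c x → InInter Φ a b c y → InInter Φ a b c z → ⊥
    no-three {x} {y} {z} x≢y x≢z y≢z (ux∈ , vx∈) (uy∈ , vy∈) (uz∈ , vz∈) =
      -- Six roots of unity describe the three points, and the goal ⊥ absorbs the double negation.
      extend-all (primeSubfield-hom p·1≡0ᶠ p·1≡0ᴱ) Ψ
        (All.map (F.lagrange Φ) (ux∈ ∷ uy∈ ∷ uz∈ ∷ vx∈ ∷ vy∈ ∷ vz∈ ∷ []))
        λ (_ , T-hom , covers) → no-three-on-line Ψ circular T-hom
          (F.*-nonzero b≢0 (F.inv≢0 a≢0)) (F.*-nonzero c≢0 (F.inv≢0 a≢0))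
          (v-injective x≢y) (u-injective x≢y) (u-injective x≢z) (u-injective y≢z)
          (line x) (line y) (line z) covers

-- Intersections with the unit circle

module UnitCircle {F : FiniteField} {k : ℕ} (Φ : Subgroup F k) where
  open Field F
  open Polynomials F using (root-of-unity⇒mem)
  open Subgroup Φ
  open Circles Φ

  involution-^-even : ∀ {x} → x * x ≡ 1# → ∀ n → 2 ∣ n → x ^ n ≡ 1#
  involution-^-even x²≡1 0 _ = refl
  involution-^-even x²≡1 1 2∣1 = contradiction (∣⇒≤ 2∣1) (ℕₚ.<⇒≱ (s≤s (s≤s z≤n)))
  involution-^-even {x} x²≡1 (suc (suc n)) 2∣2+n = begin
    x * (x * x ^ n)  ≡⟨ *-assoc x x (x ^ n) ⟨
    x * x * x ^ n    ≡⟨ cong₂ _*_ x²≡1 (involution-^-even x²≡1 n (∣m+n∣m⇒∣n 2∣2+n ∣-refl)) ⟩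
    1# * 1#          ≡⟨ *-identityˡ 1# ⟩
    1#               ∎
    where open ≡-Reasoning

  involution-^-odd : ∀ {x} → x * x ≡ 1# → ∀ n → ¬ 2 ∣ n → x ^ n ≡ x
  involution-^-odd x²≡1 0 2∤0 = contradiction (2 ∣0) 2∤0
  involution-^-odd {x} x²≡1 1 _ = *-identityʳ x
  involution-^-odd {x} x²≡1 (suc (suc n)) 2∤2+n = begin
    x * (x * x ^ n)  ≡⟨ *-assoc x x (x ^ n) ⟨
    x * x * x ^ n    ≡⟨ cong₂ _*_ x²≡1 (involution-^-odd x²≡1 n (2∤2+n ∘ ∣m∣n⇒∣m+n ∣-refl)) ⟩
    1# * x           ≡⟨ *-identityˡ x ⟩
    x                ∎
    where open ≡-Reasoning

  -1²≡1 : (- 1#) * (- 1#) ≡ 1#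
  -1²≡1 = solve 0 ((:- :1) :* (:- :1) := :1) refl

  -- For even k, -1 is a k-th root of unity, and Φ contains all of these.
  even-order⇒-1∈ : 2 ∣ k → mem (- 1#)
  even-order⇒-1∈ 2∣k = root-of-unity⇒mem Φ (involution-^-even -1²≡1 k 2∣k)

  odd-order-involution : ¬ 2 ∣ k → ∀ {x} → mem x → x * x ≡ 1# → x ≡ 1#
  odd-order-involution 2∤k x∈ x²≡1 = trans (sym (involution-^-odd x²≡1 k 2∤k)) (lagrange Φ x∈)

  neg∈ : mem (- 1#) → ∀ {x} → mem x → mem (- x)
  neg∈ -1∈ {x} x∈ = subst mem (solve 1 (λ x → (:- :1) :* x := :- x) refl x) (mul∈ -1∈ x∈)

  module _ {a : Carrier} (a≢0 : a ≢ 0#) where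

    Point : Carrier → Set
    Point x = mem x × ∃ λ v → mem v × x ≡ a * v + 1#

    point⇒InInter : ∀ {x} → Point x → InInter Φ 1# a 1# x
    point⇒InInter (x∈ , _ , v∈ , x≡) = unit-InInter⇐ a≢0 x∈ v∈ x≡

    bracket≡0 : (∀ {x} → ¬ Point x) → bracket Φ a 1# ≡ 0
    bracket≡0 none = count≡0 (inInter? Φ 1# a 1#) (none ∘ unit-InInter⇒ a≢0)

    bracket≡1 : ∀ {x} → Point x → (∀ {y} → Point y → y ≡ x) → bracket Φ a 1# ≡ 1
    bracket≡1 x unique = count≡1 (inInter? Φ 1# a 1#) (point⇒InInter x) (unique ∘ unit-InInter⇒ a≢0)

    bracket≡2 : IsCircular Φ → ∀ {x y} → x ≢ y → Point x → Point y → bracket Φ a 1# ≡ 2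
    bracket≡2 circular x≢y x y = ℕₚ.≤-antisym (circular 1# a 1# 1≢0 a≢0 1≢0)
      (count≥2 (inInter? Φ 1# a 1#) x≢y (point⇒InInter x) (point⇒InInter y))

    -- Solving a = φ (ψ - 1) for ψ gives ψ = a φ⁻¹ + 1: the cosets containing a record the points of
    -- the intersection.
    coset⇒point : ∀ {ψ φ} → mem ψ → mem φ → a ≡ φ * (ψ + (- 1#)) → Point ψ
    coset⇒point {ψ} {φ} ψ∈ φ∈ a≡ = ψ∈ , inv φ , inv∈ φ∈ , sym (begin
      a * inv φ + 1#
        ≡⟨ cong (λ w → w * inv φ + 1#) a≡ ⟩
      φ * (ψ + (- 1#)) * inv φ + 1#
        ≡⟨ solve 3 (λ f s i → f :* (s :- :1) :* i :+ :1 := f :* i :* (s :- :1) :+ :1)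
             refl φ ψ (inv φ) ⟩
      φ * inv φ * (ψ + (- 1#)) + 1#
        ≡⟨ cong (λ w → w * (ψ + (- 1#)) + 1#) (inv-spec φ (mem≢0 φ∈)) ⟩
      1# * (ψ + (- 1#)) + 1#
        ≡⟨ solve 1 (λ s → :1 :* (s :- :1) :+ :1 := s) refl ψ ⟩
      ψ ∎)
      where open ≡-Reasoning

    point⇒coset : ∀ {ψ} → Point ψ → ∃ λ φ → mem φ × a ≡ φ * (ψ + (- 1#))
    point⇒coset {ψ} (_ , v , v∈ , ψ≡) = inv v , inv∈ v∈ , sym (begin
      inv v * (ψ + (- 1#))
        ≡⟨ cong (λ w → inv v * (w + (- 1#))) ψ≡ ⟩
      inv v * (a * v + 1# + (- 1#))
        ≡⟨ solve 3 (λ i a v → i :* (a :* v :+ :1 :- :1) := v :* i :* a) refl (inv v) a v ⟩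
      v * inv v * a
        ≡⟨ cong (_* a) (inv-spec v (mem≢0 v∈)) ⟩
      1# * a
        ≡⟨ *-identityˡ a ⟩
      a ∎)
      where open ≡-Reasoning

    point≢1 : ∀ {x} → Point x → x ≢ 1#
    point≢1 (_ , v , v∈ , x≡) x≡1 = *-nonzero a≢0 (mem≢0 v∈)
      (+-cancelʳ (trans (sym x≡) (trans x≡1 (sym (+-identityˡ 1#)))))

    -- Dividing x = a v + 1 by x gives x⁻¹ = a (- v x⁻¹) + 1, and -1 ∈ Φ keeps the new parameter in
    -- Φ.
    inverse-point : mem (- 1#) → ∀ {x} → Point x → Point (inv x)
    inverse-point -1∈ {x} (x∈ , v , v∈ , x≡) =
      inv∈ x∈ , - (v * inv x) , neg∈ -1∈ (mul∈ v∈ (inv∈ x∈)) , sym (begin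
        a * (- (v * inv x)) + 1#
          ≡⟨ solve 3 (λ a v i → a :* (:- (v :* i)) :+ :1 := (:- ((a :* v :+ :1) :* i)) :+ i :+ :1)
               refl a v (inv x) ⟩
        (- ((a * v + 1#) * inv x)) + inv x + 1#
          ≡⟨ cong (λ w → (- (w * inv x)) + inv x + 1#) x≡ ⟨
        (- (x * inv x)) + inv x + 1#
          ≡⟨ cong (λ w → (- w) + inv x + 1#) (inv-spec x (mem≢0 x∈)) ⟩
        (- 1#) + inv x + 1#
          ≡⟨ solve 1 (λ i → (:- :1) :+ i :+ :1 := i) refl (inv x) ⟩
        inv x ∎)
      where open ≡-Reasoning

    bracket≡2-from-point : IsCircular Φ → mem (- 1#) → ∀ {x} → Point x → x * x ≢ 1# →
      bracket Φ a 1# ≡ 2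
    bracket≡2-from-point circular -1∈ {x} point x²≢1 =
      bracket≡2 circular x≢x⁻¹ point (inverse-point -1∈ point)
      where
      x≢x⁻¹ : x ≢ inv x
      x≢x⁻¹ x≡x⁻¹ = x²≢1 (trans (cong (x *_) x≡x⁻¹) (inv-spec x (mem≢0 (proj₁ point))))

    -- If x − 1 = l (y − 1), then x, l, 1 and l y all lie on the circle
    -- (x + l) − Φ = (1 + l y) − Φ, and on Φ.
    point-unique : IsCircular Φ → ¬ mem (- 1#) → 1# + 1# ≢ 0# → ∀ {x y} → Point x → Point y → y ≡ x
    point-unique circular -1∉ 2≢0 {x} {y} X@(x∈ , v , v∈ , x≡) Y@(y∈ , w , w∈ , y≡) with y ≟ x
    ... | yes y≡x = y≡x
    ... | no y≢x  = ⊥-elim (three-points (l ≟ x))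
      where
      open ≡-Reasoning
      -- The ratio of x - 1 = a v to y - 1 = a w.
      l : Carrier
      l = v * inv w

      l∈ : mem l
      l∈ = mul∈ v∈ (inv∈ w∈)

      sum≡ : x + l ≡ 1# + l * y
      sum≡ = sym (begin
        1# + l * y
          ≡⟨ cong (λ z → 1# + l * z) y≡ ⟩
        1# + v * inv w * (a * w + 1#)
          ≡⟨ solve 4 (λ v i a w → :1 :+ v :* i :* (a :* w :+ :1) := a :* v :* (w :* i) :+ :1 :+ v :* i)
               refl v (inv w) a w ⟩
        a * v * (w * inv w) + 1# + l
          ≡⟨ cong (λ z → a * v * z + 1# + l) (inv-spec w (mem≢0 w∈)) ⟩
        a * v * 1# + 1# + l
          ≡⟨ cong (λ z → z + 1# + l) (*-identityʳ (a * v)) ⟩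
        a * v + 1# + l
          ≡⟨ cong (_+ l) x≡ ⟨
        x + l ∎)

      -- Circularity needs a nonzero centre; a zero one would make l x⁻¹ = -1 a member of Φ.
      sum≢0 : x + l ≢ 0#
      sum≢0 x+l≡0 = -1∉ (subst mem ratio (mul∈ l∈ (inv∈ x∈)))
        where
        ratio : l * inv x ≡ - 1#
        ratio = begin
          l * inv x        ≡⟨ cong (_* inv x) (sum≡0⇒≡- x+l≡0) ⟩
          (- x) * inv x    ≡⟨ solve 2 (λ x i → (:- x) :* i := :- (x :* i)) refl x (inv x) ⟩
          - (x * inv x)    ≡⟨ cong -_ (inv-spec x (mem≢0 x∈)) ⟩
          - 1#             ∎

      -1≢0 : - 1# ≢ 0#
      -1≢0 -1≡0 =
        1≢0 (trans (solve 0 (:1 := :- (:- :1)) refl) (trans (cong -_ -1≡0) (solve 0 (:- :0 := :0) refl)))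

      -- Two members of Φ with sum x + l put each other on the circle Φ (-1) + (x + l), each being
      -- the parameter of the other.
      reflect : ∀ s t → s ≡ (- 1#) * t + (s + t)
      reflect s t = solve 2 (λ s t → s := (:- :1) :* t :+ (s :+ t)) refl s t

      x-on : x ≡ (- 1#) * l + (x + l)
      x-on = reflect x l

      l-on : l ≡ (- 1#) * x + (x + l)
      l-on = trans (reflect l x) (cong ((- 1#) * x +_) (+-comm l x))

      1-on : 1# ≡ (- 1#) * (l * y) + (x + l)
      1-on = trans (reflect 1# (l * y)) (cong ((- 1#) * (l * y) +_) (sym sum≡))

      ly-on : l * y ≡ (- 1#) * 1# + (x + l)
      ly-on = trans (reflect (l * y) 1#) (cong ((- 1#) * 1# +_) (trans (+-comm (l * y) 1#) (sym sum≡)))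

      l≢1 : l ≢ 1#
      l≢1 l≡1 = y≢x (+-cancelʳ (begin
        y + 1#        ≡⟨ +-comm y 1# ⟩
        1# + y        ≡⟨ cong (1# +_) (*-identityˡ y) ⟨
        1# + 1# * y   ≡⟨ cong (λ z → 1# + z * y) l≡1 ⟨
        1# + l * y    ≡⟨ sum≡ ⟨
        x + l         ≡⟨ cong (x +_) l≡1 ⟩
        x + 1#        ∎))

      1≢x : 1# ≢ x
      1≢x = point≢1 X ∘ sym

      ly∈ : mem (l * y)
      ly∈ = mul∈ l∈ y∈

      -- The points 1, x, l are distinct unless l = x, and then l y takes the place of l.
      three-points : Dec (l ≡ x) → ⊥
      three-points (no l≢x)  = no-three circular -1≢0 sum≢0 1≢x (l≢1 ∘ sym) (l≢x ∘ sym)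
                        one∈ ly∈ 1-on x∈ l∈ x-on l∈ x∈ l-on
      three-points (yes l≡x) = no-three circular -1≢0 sum≢0 1≢x 1≢ly x≢ly
                        one∈ ly∈ 1-on x∈ l∈ x-on ly∈ one∈ ly-on
        where
        1≢ly : 1# ≢ l * y
        -- With l = x and l y = 1 the two equal sums read 2 x = 2, so x = 1 because 2 ≠ 0.
        1≢ly 1≡ly = *-nonzero 2≢0 (≢⇒difference≢0 (1≢x ∘ sym)) (begin
          (1# + 1#) * (x + (- 1#))
            ≡⟨ solve 1 (λ x → (:1 :+ :1) :* (x :- :1) := (x :+ x) :- (:1 :+ :1)) refl x ⟩
          (x + x) + (- (1# + 1#))
            ≡⟨ cong₂ (λ s t → (x + s) + (- (1# + t))) (sym l≡x) 1≡ly ⟩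
          (x + l) + (- (1# + l * y))
            ≡⟨ cong (λ s → s + (- (1# + l * y))) sum≡ ⟩
          (1# + l * y) + (- (1# + l * y))
            ≡⟨ -‿inverseʳ _ ⟩
          0# ∎)
        x≢ly : x ≢ l * y
        x≢ly x≡ly = point≢1 Y (*-cancelʳ (mem≢0 l∈) (begin
          y * l   ≡⟨ *-comm y l ⟩
          l * y   ≡⟨ x≡ly ⟨
          x       ≡⟨ l≡x ⟨
          l       ≡⟨ *-identityˡ l ⟨
          1# * l  ∎))

    -- Since -1 ∈ Φ, the set 2 Φ is Φ (ψ - 1) for ψ = -1.
    doubled-coset⇒point : mem (- 1#) → ∀ {φ} → mem φ → a ≡ (1# + 1#) * φ → Point (- 1#)
    doubled-coset⇒point -1∈ {φ} φ∈ a≡ = coset⇒point -1∈ (neg∈ -1∈ φ∈)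
      (trans a≡ (solve 1 (λ f → (:1 :+ :1) :* f := (:- f) :* ((:- :1) :- :1)) refl φ))

    point⇒doubled-coset : Point (- 1#) → ∃ λ φ → mem φ × a ≡ (1# + 1#) * φ
    point⇒doubled-coset P@(-1∈ , _) =
      let φ , φ∈ , a≡ = point⇒coset P in
      - φ , neg∈ -1∈ φ∈ , trans a≡ (solve 1 (λ f → f :* ((:- :1) :- :1) := (:1 :+ :1) :* (:- f))
           refl φ)

    ≢-1∧square≡1⇒≡1 : ∀ {x} → x ≢ - 1# → x * x ≡ 1# → x ≡ 1#
    ≢-1∧square≡1⇒≡1 {x} x≢-1 x²≡1 = difference≡0⇒≡ (*-cancelˡ-zero (≢⇒difference≢0 x≢-1) (begin
      (x + (- (- 1#))) * (x + (- 1#))  ≡⟨ solve 1 (λ x → (x :- (:- :1)) :* (x :- :1) := x :* x :- :1)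
           refl x ⟩
      x * x + (- 1#)                   ≡⟨ cong (_+ (- 1#)) x²≡1 ⟩
      1# + (- 1#)                      ≡⟨ -‿inverseʳ 1# ⟩
      0# ∎))
      where open ≡-Reasoning

-- The projections opened here would clash with the field operations above.
open import Defs
open import Data.Nat using (ℕ; _≤_; _^_; _∸_)
open import Data.Nat.Divisibility using (_∣_)
open import Data.Nat.Primality using (Prime)
open import Data.Product using (Σ; _×_)
open import Relation.Nullary using (¬_)
open import Relation.Binary.PropositionalEquality using (_≡_; _≢_)

-- Circularity of `Φ` from that of the pair, and the bracket by the parity of `k`

circularPair⇒circular : ∀ {p r k} → Prime p → (F : FiniteField) → size F ≡ p ^ r →
  (Φ : Subgroup F k) → CircularPair p k → IsCircular Φ
circularPair⇒circular {k = zero}  _ F _ Φ _ = contradiction (Field.order-positive F Φ) λ ()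
-- Both sizes are powers of p, so both fields have characteristic p.
circularPair⇒circular {p} {r} {suc n} p-prime F size≡ Φ (E , r' , sizeᴱ≡ , _ , Ψ , circular) =
  Modisett.circular-transfer p-prime F E
    (Characteristic.size-characteristic F {p} {r} size≡) (Characteristic.size-characteristic E {p} {r'} sizeᴱ≡)
    Φ Ψ circular

theorem15 : (p r k : ℕ) → Prime p → 3 ≤ k → k ∣ p ^ r ∸ 1 →
    (F : FiniteField) → size F ≡ p ^ r → (Φ : Subgroup F k) →
    CircularPair p k →
    (a : Carrier F) → a ≢ 0# F →
    ((2 ∣ k) →
    ((Σ (Carrier F) λ ψ → mem Φ ψ × ψ ≢ 1# F × ψ ≢ (-_ F) (1# F) ×
    Σ (Carrier F) λ φ → mem Φ φ × a ≡ _*_ F φ (_-_ F ψ (1# F))) → bracket Φ a (1# F) ≡ 2)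
    × (¬ (Σ (Carrier F) λ ψ → mem Φ ψ × ψ ≢ 1# F × ψ ≢ (-_ F) (1# F) ×
    Σ (Carrier F) λ φ → mem Φ φ × a ≡ _*_ F φ (_-_ F ψ (1# F))) →
    (Σ (Carrier F) λ φ → mem Φ φ × a ≡ _*_ F (_+_ F (1# F) (1# F)) φ) →
    bracket Φ a (1# F) ≡ 1)
    × (¬ (Σ (Carrier F) λ ψ → mem Φ ψ × ψ ≢ 1# F × ψ ≢ (-_ F) (1# F) ×
    Σ (Carrier F) λ φ → mem Φ φ × a ≡ _*_ F φ (_-_ F ψ (1# F))) →
    ¬ (Σ (Carrier F) λ φ → mem Φ φ × a ≡ _*_ F (_+_ F (1# F) (1# F)) φ) →
    bracket Φ a (1# F) ≡ 0))
    ×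
    (¬ (2 ∣ k) →
    (p ≡ 2 → (Σ (Carrier F) λ ψ → mem Φ ψ × ψ ≢ 1# F ×
    Σ (Carrier F) λ φ → mem Φ φ × a ≡ _*_ F φ (_-_ F ψ (1# F))) → bracket Φ a (1# F) ≡ 2)
    × (p ≢ 2 → (Σ (Carrier F) λ ψ → mem Φ ψ × ψ ≢ 1# F ×
    Σ (Carrier F) λ φ → mem Φ φ × a ≡ _*_ F φ (_-_ F ψ (1# F))) → bracket Φ a (1# F) ≡ 1)
    × (¬ (Σ (Carrier F) λ ψ → mem Φ ψ × ψ ≢ 1# F ×
    Σ (Carrier F) λ φ → mem Φ φ × a ≡ _*_ F φ (_-_ F ψ (1# F))) → bracket Φ a (1# F) ≡ 0))
theorem15 p r k p-prime _ _ F size≡ Φ pair a a≢0 = even , odd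
  where
  module 𝔽 = Field F
  open UnitCircle Φ

  circular : IsCircular Φ
  circular = circularPair⇒circular {r = r} p-prime F size≡ Φ pair

  p·1≡0 : p 𝔽.· 1# F ≡ 0# F
  p·1≡0 = Characteristic.size-characteristic F {p} {r} size≡

  2·1≡1+1 : 2 𝔽.· 1# F ≡ _+_ F (1# F) (1# F)
  2·1≡1+1 = cong (_+_ F (1# F)) (𝔽.+-identityʳ (1# F))

  even : 2 ∣ k → _
  even 2∣k =
      -- From ψ ≠ ±1 follows ψ² ≠ 1, so ψ and ψ⁻¹ are two different points.
      (λ (ψ , ψ∈ , ψ≢1 , ψ≢-1 , φ , φ∈ , a≡) →
        bracket≡2-from-point a≢0 circular -1∈ (coset⇒point a≢0 ψ∈ φ∈ a≡)
          (ψ≢1 ∘ ≢-1∧square≡1⇒≡1 a≢0 ψ≢-1))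
    , (λ no-coset (φ , φ∈ , a≡) →
        bracket≡1 a≢0 (doubled-coset⇒point a≢0 -1∈ φ∈ a≡) (points-are-−1 no-coset))
    , (λ no-coset no-double → bracket≡0 a≢0 λ P →
        no-double (point⇒doubled-coset a≢0 (subst (Point a≢0) (points-are-−1 no-coset P) P)))
    where
    -1∈ = even-order⇒-1∈ 2∣k

    -- Any other point would itself be an excluded ψ, as no point equals 1.
    points-are-−1 : ¬ (Σ (Carrier F) λ ψ → mem Φ ψ × ψ ≢ 1# F × ψ ≢ (-_ F) (1# F) ×
      Σ (Carrier F) λ φ → mem Φ φ × a ≡ _*_ F φ (_-_ F ψ (1# F))) →
      ∀ {x} → Point a≢0 x → x ≡ (-_ F) (1# F)
    points-are-−1 no-coset {x} P@(x∈ , _) with 𝔽._≟_ x ((-_ F) (1# F))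
    ... | yes x≡-1 = x≡-1
    ... | no x≢-1  = contradiction (x , x∈ , point≢1 a≢0 P , x≢-1 , point⇒coset a≢0 P) no-coset

  odd : ¬ (2 ∣ k) → _
  odd 2∤k =
      -- In characteristic 2, -1 = 1 lies in Φ, so inverses again pair the points; odd order rules
      -- out ψ² = 1.
      (λ p≡2 (ψ , ψ∈ , ψ≢1 , φ , φ∈ , a≡) →
        bracket≡2-from-point a≢0 circular (subst (mem Φ) (1≡-1 p≡2) (one∈ Φ))
          (coset⇒point a≢0 ψ∈ φ∈ a≡) (ψ≢1 ∘ odd-order-involution 2∤k ψ∈))
    , (λ p≢2 (ψ , ψ∈ , ψ≢1 , φ , φ∈ , a≡) →
        let P = coset⇒point a≢0 ψ∈ φ∈ a≡ in
        bracket≡1 a≢0 P (point-unique a≢0 circular (-1∉ p≢2) (2≢0 p≢2) P))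
    , (λ no-coset → bracket≡0 a≢0 λ P@(x∈ , _) →
        no-coset (_ , x∈ , point≢1 a≢0 P , point⇒coset a≢0 P))
    where
    1≡-1 : p ≡ 2 → 1# F ≡ (-_ F) (1# F)
    1≡-1 p≡2 = 𝔽.sum≡0⇒≡- (trans (sym 2·1≡1+1) (subst (λ n → n 𝔽.· 1# F ≡ 0# F) p≡2 p·1≡0))

    2≢0 : p ≢ 2 → _+_ F (1# F) (1# F) ≢ 0# F
    2≢0 p≢2 2≡0 = p≢2 (ℕₚ.≤-antisym
      (∣⇒≤ (Characteristic.characteristic-divides F {p} {2} p-prime p·1≡0 (trans 2·1≡1+1 2≡0)))
      (ℕ.nonTrivial⇒n>1 p ⦃ prime⇒nonTrivial p-prime ⦄))

    -- In a group of odd order -1 could only be 1, which would make 2 = 0.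
    -1∉ : p ≢ 2 → ¬ mem Φ ((-_ F) (1# F))
    -1∉ p≢2 -1∈ = 2≢0 p≢2 (trans
      (cong (_+_ F (1# F)) (sym (odd-order-involution 2∤k -1∈ -1²≡1)))
      (𝔽.-‿inverseʳ (1# F)))
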